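{- Let $\mathcal{E}$ and $\mathcal{F}$ be feasible and terminating bundle event structures with internal probability over a finite state space $\Omega$. If $\mathcal{E}\sqsubseteq_{\mathrm{sim}}\mathcal{F}$ then $\mathcal{E}\sqsubseteq\mathcal{F}$, i.e. $[\![\mathcal{E}]\!](s)\subseteq[\![\mathcal{F}]\!](s)$ for every $s\in\Omega$.
   Context: **Programs.** $\Omega$ is a fixed finite set of states. $\mathbb{D}\Omega$ is the set of distributions on $\Omega$, viewed inside $\mathbb{R}^\Omega$; $\mathbb{D}_{\le 1}\Omega$ is the set of subdistributions; $\delta_s$ is the point distribution at $s$. $\mathbb{H}_1\Omega$ is the set of maps $r:\Omega\to\mathcal{P}(\mathbb{D}\Omega)$ such that each $r(s)$ is non-empty, convex and topologically closed. A test is a map $b:\Omega\to\mathcal{P}(\mathbb{D}\Omega)$ with $b(s)\subseteq\{\delta_s\}$. $\overline{\mathbb{H}}_1\Omega$ is $\mathbb{H}_1\Omega$ together with all tests, ordered by $r\sqsubseteq_{\mathbb{H}}r'$ iff $r(s)\subseteq r'(s)$ for all $s$. $\delta$ denotes the program $\delta(s)=\{\delta_s\}$. **ipBES.** A bundle event structure with internal probability (ipBES) is $\mathcal{E}=(E,\mapsto,\#,\lambda,\mathbf{\Phi})$ where $E$ is a set of events; $\#$ is an irreflexive symmetric relation on $E$; for $x,x'\subseteq E$, $x\#x'$ means $e\#e'$ for all $e\in x,e'\in x'$ with $e\ne e'$; $\mapsto\subseteq\mathcal{P}(E)\times E$ satisfies $x\#x$ whenever $x\mapsto e$; $\lambda:E\to\overline{\mathbb{H}}_1\Omega$;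 $\mathbf{\Phi}\subseteq\mathcal{P}(E)$ with $x\#x$ for $x\in\mathbf{\Phi}$. **Traces.** A finite trace is a finite sequence $e_1\cdots e_n$ of distinct, pairwise non-conflicting events such that for every $j$ and every bundle $x\mapsto e_j$ there is $i<j$ with $e_i\in x$. $\mathcal{T}(\mathcal{E})$ is the set of finite traces (empty trace $\emptyset$), $\mathcal{T}_{\max}(\mathcal{E})$ the set of prefix-maximal ones. A trace $\alpha$ is weakly maximal if it is maximal or there are events $e_1,\dots,e_n$ with $\alpha e_1\cdots e_n\in\mathcal{T}_{\max}(\mathcal{E})$ and $\delta\sqsubseteq_{\mathbb{H}}\lambda(e_i)$ for all $i$. **Schedulers and semantics.** A scheduler $\sigma$ on $\mathcal{E}$ assigns to each $\alpha\in\mathcal{T}(\mathcal{E})$ a partial function $\sigma(\alpha):E\times\Omega\rightharpoonup\mathbb{D}_{\le1}\Omega$ with domain $\{(e,s):\alpha e\in\mathcal{T}(\mathcal{E}),\,s\in\Omega\}$ for which there is $w:E\times\Omega\to[0,1]$ (depending on $\alpha$) such that for $(e,s)$ in the domain: if $\lambda(e)(s)\neq\emptyset$ then $\sigma(\alpha)(e,s)=w(e,s)\mu$ for some $\mu\in\lambda(e)(s)$; if $\lambda(e)(s)=\emptyset$ then $w(e,s)=0$ and $\sigma(\alpha)(e,s)=0$; and, when the domain is non-empty, $\sum_{e:\alpha e\in\mathcal{T}(\mathcal{E})}w(e,s)=1$ for every $s$. From initial state $s$, define $\varphi_s(\emptyset)=\delta_s$, $\varphi_s(\alpha e)(u)=\sum_{t\in\Omega}\sigma(\alpha)(e,t)(u)\varphi_s(\alpha)(t)$,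 and $\sigma_s(\mathcal{E})=\sum_{\alpha\in\mathcal{T}_{\max}(\mathcal{E})}\varphi_s(\alpha)$. $\mathbf{Sched}_1(\mathcal{E})$ is the set of schedulers $\sigma$ such that $\sigma_s(\mathcal{E})$ is a distribution for every $s$. $\mathcal{E}$ is feasible if for every $\alpha\in\mathcal{T}(\mathcal{E})\setminus\mathcal{T}_{\max}(\mathcal{E})$, $\bigcup_{\alpha e\in\mathcal{T}(\mathcal{E})}\{s:\lambda(e)(s)\ne\emptyset\}=\Omega$; it is terminating if $\mathbf{Sched}_1(\mathcal{E})\neq\emptyset$. $[\![\mathcal{E}]\!](s)$ is the topological closure of the convex hull of $\{\sigma_s(\mathcal{E}):\sigma\in\mathbf{Sched}_1(\mathcal{E})\}$. For feasible $\mathcal{E},\mathcal{F}$, $\mathcal{E}\sqsubseteq\mathcal{F}$ means $[\![\mathcal{E}]\!]\sqsubseteq_{\mathbb{H}}[\![\mathcal{F}]\!]$. **t-simulation.** A function $f:\mathcal{T}(\mathcal{E})\to\mathcal{T}(\mathcal{F})$ is a t-simulation if: (i) $f(\emptyset)=\emptyset$ and $f^{ -1}(\beta)$ is finite for every $\beta\in\mathcal{T}(\mathcal{F})$; (ii) if $\alpha e\in\mathcal{T}(\mathcal{E})$ then either $f(\alpha e)=f(\alpha)$ and $\lambda(e)\sqsubseteq_{\mathbb{H}}\delta$, or there is an event $e'$ of $\mathcal{F}$ with $\lambda(e)\sqsubseteq_{\mathbb{H}}\lambda(e')$ and $f(\alpha e)=f(\alpha)e'$; (iii) if $\alpha e$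 is maximal in $\mathcal{T}(\mathcal{E})$ then $f(\alpha e)=f(\alpha)e'$ for some $e'$ with $\lambda(e)\sqsubseteq_{\mathbb{H}}\lambda(e')$, and $f(\alpha e)$ is weakly maximal in $\mathcal{T}(\mathcal{F})$. $\mathcal{E}\sqsubseteq_{\mathrm{sim}}\mathcal{F}$ means there is a t-simulation from $\mathcal{E}$ to $\mathcal{F}$.
   Formalization: Adds the hypothesis that if the empty trace is maximal in E, then it is weakly maximal in F; without it the claim fails, e.g. E without events and F with a single event labelled by the constant program s ↦ {δ_1} on Ω = {0,1}. -}

module Defs where

open import Level using (Level; 0ℓ; suc; _⊔_)
open import Algebra.Bundles using (CommutativeRing)
open import Data.Bool.Base using (if_then_else_)
open import Data.Fin.Base using (Fin)
open import Data.Fin.Properties using (_≟_)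
open import Data.List.Base using (List; []; _∷_; _++_; foldr)
open import Data.List.Membership.Propositional using (_∈_; _∉_)
open import Data.List.Relation.Unary.All using (All)
open import Data.List.Relation.Unary.Any using (Any)
open import Data.List.Relation.Unary.Unique.Propositional using (Unique)
open import Data.Nat.Base using (ℕ)
open import Data.Product.Base using (Σ; ∃; Σ-syntax; ∃-syntax; _×_; _,_)
open import Data.Sum.Base using (_⊎_)
open import Data.Vec.Functional using (Vector)
open import Relation.Binary.Core using (Rel)
open import Relation.Binary.Definitions using (Irreflexive; Symmetric; _Respects_)
open import Relation.Binary.PropositionalEquality.Core using (_≡_; _≢_)
open import Relation.Binary.Structures using (IsTotalOrder)
open import Relation.Nullary.Decidable.Core using (does)
open import Relation.Nullary.Negation.Core using (¬_)
open import Relation.Unary using (Pred; _⊆_; Satisfiable; Empty)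

-- The real numbers, characterised up to isomorphism as a Dedekind-complete
-- ordered field; equality is the setoid equality of the underlying ring.

record CompleteOrderedField : Set₁ where
  infix 4 _≤_
  field
    commutativeRing : CommutativeRing 0ℓ 0ℓ
  open CommutativeRing commutativeRing public
  field
    _≤_          : Rel Carrier 0ℓ
    isTotalOrder : IsTotalOrder _≈_ _≤_
    +-monoˡ-≤    : ∀ z {x y} → x ≤ y → x + z ≤ y + z
    *-nonNeg     : ∀ {x y} → 0# ≤ x → 0# ≤ y → 0# ≤ x * y
    1≉0          : ¬ (1# ≈ 0#)
    inverse      : ∀ x → ¬ (x ≈ 0#) → ∃[ y ] x * y ≈ 1#

  IsUpperBound : ∀ {a} → Pred Carrier a → Carrier → Set a
  IsUpperBound P b = ∀ x → P x → x ≤ b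

  IsLub : ∀ {a} → Pred Carrier a → Carrier → Set a
  IsLub P v = IsUpperBound P v × (∀ b → IsUpperBound P b → v ≤ b)

  field
    complete : (P : Pred Carrier 0ℓ) → Satisfiable P → ∃ (IsUpperBound P) → ∃ (IsLub P)

  infix 4 _<_
  _<_ : Rel Carrier 0ℓ
  x < y = x ≤ y × ¬ (x ≈ y)

  -- The sum of g over the elements of P, a set of any cardinality, as the
  -- supremum of the finite partial sums.  Used only for g non-negative on P.
  HasSum : ∀ {a p} {A : Set a} → Pred A p → (A → Carrier) → Carrier → Set (a ⊔ p)
  HasSum {A = A} P g = IsLub λ v →
    Σ[ l ∈ List A ] Unique l × All P l × v ≈ foldr (λ a acc → g a + acc) 0# l

-- The state space Ω is Fin n.

module Programs (ℝ : CompleteOrderedField) (n : ℕ) where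

  open CompleteOrderedField ℝ
  open import Algebra.Properties.Monoid.Sum +-monoid using (sum)

  Ω : Set
  Ω = Fin n

  Point : Set
  Point = Vector Carrier n

  infix 4 _≋_
  _≋_ : Rel Point 0ℓ
  μ ≋ ν = ∀ u → μ u ≈ ν u

  infixr 7 _·_
  _·_ : Carrier → Point → Point
  (c · μ) u = c * μ u

  infixl 6 _⊕_
  _⊕_ : Point → Point → Point
  (μ ⊕ ν) u = μ u + ν u

  𝟎 : Point
  𝟎 _ = 0#

  δ[_] : Ω → Point
  δ[ s ] u = if does (s ≟ u) then 1# else 0#

  IsDist : Pred Point 0ℓ
  IsDist μ = (∀ u → 0# ≤ μ u) × sum μ ≈ 1#

  IsSubDist : Pred Point 0ℓ
  IsSubDist μ = (∀ u → 0# ≤ μ u) × sum μ ≤ 1#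

  Convex : ∀ {a} → Pred Point a → Set a
  Convex A = ∀ {μ ν} → A μ → A ν → ∀ p → 0# ≤ p → p ≤ 1# → A (p · μ ⊕ (1# - p) · ν)

  ConvexHull : ∀ {a} → Pred Point a → Pred Point a
  ConvexHull A x = Σ[ k ∈ ℕ ] Σ[ c ∈ Vector Carrier k ] Σ[ y ∈ Vector Point k ]
    (∀ i → 0# ≤ c i) × sum c ≈ 1# × (∀ i → A (y i)) × x ≋ (λ u → sum λ i → c i * y i u)

  Near : Carrier → Rel Point 0ℓ
  Near ε x y = ∀ u → x u - y u < ε × y u - x u < ε

  Closure : ∀ {a} → Pred Point a → Pred Point a
  Closure A x = ∀ ε → 0# < ε → ∃[ y ] A y × Near ε x y

  Closed : ∀ {a} → Pred Point a → Set a
  Closed A = Closure A ⊆ A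

  record 𝒫𝔻 : Set₁ where
    field
      mem  : Pred Point 0ℓ
      resp : mem Respects _≋_
      dist : mem ⊆ IsDist
  open 𝒫𝔻 public

  IsProgram : (Ω → 𝒫𝔻) → Set
  IsProgram r = ∀ s → Satisfiable (mem (r s)) × Convex (mem (r s)) × Closed (mem (r s))

  IsTest : (Ω → 𝒫𝔻) → Set
  IsTest b = ∀ s → mem (b s) ⊆ (_≋ δ[ s ])

  record ℍ̄₁ : Set₁ where
    field
      at   : Ω → 𝒫𝔻
      kind : IsProgram at ⊎ IsTest at

    ⟨_⟩ : Ω → Pred Point 0ℓ
    ⟨_⟩ s = mem (at s)
  open ℍ̄₁ public using (⟨_⟩)

  infix 4 _⊑ℍ_
  _⊑ℍ_ : ∀ {a b} → (Ω → Pred Point a) → (Ω → Pred Point b) → Set (a ⊔ b)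
  r ⊑ℍ r′ = ∀ s → r s ⊆ r′ s

  δ : Ω → Pred Point 0ℓ
  δ s = _≋ δ[ s ]

  record IPBES : Set₁ where
    infix 4 _#_ _##_ _↦_
    field
      Event    : Set
      _#_      : Rel Event 0ℓ
      #-irrefl : Irreflexive _≡_ _#_
      #-sym    : Symmetric _#_

    _##_ : Rel (Pred Event 0ℓ) 0ℓ
    x ## x′ = ∀ {e e′} → x e → x′ e′ → e ≢ e′ → e # e′

    field
      _↦_        : Pred Event 0ℓ → Event → Set
      ↦-conflict : ∀ {x e} → x ↦ e → x ## x
      lab        : Event → ℍ̄₁
      Φ          : Pred (Pred Event 0ℓ) 0ℓ
      Φ-conflict : ∀ {x} → Φ x → x ## x

  -- Sequences of events are lists with the latest event at the head, so that
  -- the sequence α followed by γ is γ ++ α.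

  infixl 5 _▸_
  pattern _▸_ α e = e ∷ α

  module _ (𝓔 : IPBES) where
    open IPBES 𝓔

    data IsTrace : List Event → Set₁ where
      empty  : IsTrace []
      extend : ∀ {α e} → IsTrace α → e ∉ α → All (λ e′ → ¬ (e # e′)) α →
               (∀ x → x ↦ e → Any x α) → IsTrace (α ▸ e)

    -- The validity proof is irrelevant, so that two traces are equal as soon
    -- as they have the same events.
    record Trace : Set₁ where
      constructor ⟪_,_⟫
      field
        events   : List Event
        .isTrace : IsTrace events

    IsMaximal : Pred (List Event) (suc 0ℓ)
    IsMaximal α = IsTrace α × (∀ γ → IsTrace (γ ++ α) → γ ≡ [])

    IsWeaklyMaximal : Pred (List Event) (suc 0ℓ)
    IsWeaklyMaximal α = IsMaximal α ⊎
      ∃[ γ ] IsMaximal (γ ++ α) × All (λ e → δ ⊑ℍ ⟨ lab e ⟩) γ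

  prefix : ∀ {𝓔 α e} → IsTrace 𝓔 (α ▸ e) → IsTrace 𝓔 α
  prefix (extend t _ _ _) = t

  module _ (𝓔 : IPBES) where
    open IPBES 𝓔
    open Trace

    -- The irrelevant argument restricts the partial function attached to α to
    -- its domain.
    PreScheduler : Set₁
    PreScheduler = (α : Trace 𝓔) (e : Event) → .(IsTrace 𝓔 (events α ▸ e)) → Ω → Point

    IsScheduler : PreScheduler → Set₁
    IsScheduler σ = ∀ α →
      (∀ e (t : IsTrace 𝓔 (events α ▸ e)) s → IsSubDist (σ α e t s)) ×
      Σ[ w ∈ (Event → Ω → Carrier) ]
        (∀ e s → 0# ≤ w e s × w e s ≤ 1#) ×
        (∀ e (t : IsTrace 𝓔 (events α ▸ e)) s →
          (Satisfiable (⟨ lab e ⟩ s) → ∃[ μ ] ⟨ lab e ⟩ s μ × σ α e t s ≋ w e s · μ) ×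
          (Empty (⟨ lab e ⟩ s) → w e s ≈ 0# × σ α e t s ≋ 𝟎)) ×
        (∃[ e ] IsTrace 𝓔 (events α ▸ e) →
          ∀ s → HasSum (λ e → IsTrace 𝓔 (events α ▸ e)) (λ e → w e s) 1#)

    φ-list : PreScheduler → Ω → (α : List Event) → .(IsTrace 𝓔 α) → Point
    φ-list σ s []      _ = δ[ s ]
    φ-list σ s (α ▸ e) t = λ u →
      sum λ v → σ ⟪ α , prefix t ⟫ e t v u * φ-list σ s α (prefix t) v

    φ : PreScheduler → Ω → Trace 𝓔 → Point
    φ σ s ⟪ α , t ⟫ = φ-list σ s α t

    -- Outcome σ s μ says that μ is σ_s(𝓔); stated as a relation because the sum
    -- over the maximal traces is defined as a supremum.
    Outcome : PreScheduler → Ω → Pred Point (suc 0ℓ)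
    Outcome σ s μ = ∀ u →
      HasSum (λ α → IsMaximal 𝓔 (events α)) (λ α → φ σ s α u) (μ u)

    Sched₁ : Pred PreScheduler (suc 0ℓ)
    Sched₁ σ = IsScheduler σ × (∀ s → ∃[ μ ] Outcome σ s μ × IsDist μ)

    Feasible : Set₁
    Feasible = ∀ α → IsTrace 𝓔 α → ¬ IsMaximal 𝓔 α →
      ∀ s → ∃[ e ] IsTrace 𝓔 (α ▸ e) × Satisfiable (⟨ lab e ⟩ s)

    Terminating : Set₁
    Terminating = Satisfiable Sched₁

    ⟦_⟧ : Ω → Pred Point (suc 0ℓ)
    ⟦_⟧ s = Closure (ConvexHull λ μ → ∃[ σ ] Sched₁ σ × Outcome σ s μ)

  infix 4 _⊑_ _⊑sim_
  _⊑_ : Rel IPBES (suc 0ℓ)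
  𝓔 ⊑ 𝓕 = ⟦ 𝓔 ⟧ ⊑ℍ ⟦ 𝓕 ⟧

  module _ (𝓔 𝓕 : IPBES) where
    private
      module E = IPBES 𝓔
      module F = IPBES 𝓕
    open Trace

    -- f sends α followed by e to f(α) followed by some e′ above e.
    Tracks : (Trace 𝓔 → Trace 𝓕) → (α : Trace 𝓔) (e : E.Event) →
             .(IsTrace 𝓔 (events α ▸ e)) → Set
    Tracks f α e t = ∃[ e′ ] ⟨ E.lab e ⟩ ⊑ℍ ⟨ F.lab e′ ⟩ ×
                             events (f ⟪ events α ▸ e , t ⟫) ≡ events (f α) ▸ e′

    -- f-maximal does not constrain f at the empty trace, even when that trace
    -- is maximal in 𝓔.
    record IsTSimulation (f : Trace 𝓔 → Trace 𝓕) : Set₁ where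
      field
        f-empty   : f ⟪ [] , empty ⟫ ≡ ⟪ [] , empty ⟫
        f-finite  : ∀ β → ∃[ l ] (∀ α → f α ≡ β → α ∈ l)
        f-step    : ∀ α e (t : IsTrace 𝓔 (events α ▸ e)) →
                    (f ⟪ events α ▸ e , t ⟫ ≡ f α × ⟨ E.lab e ⟩ ⊑ℍ δ) ⊎ Tracks f α e t
        f-maximal : ∀ α e (t : IsTrace 𝓔 (events α ▸ e)) → IsMaximal 𝓔 (events α ▸ e) →
                    Tracks f α e t ×
                    IsWeaklyMaximal 𝓕 (events (f ⟪ events α ▸ e , t ⟫))

  _⊑sim_ : Rel IPBES (suc 0ℓ)
  𝓔 ⊑sim 𝓕 = ∃ (IsTSimulation 𝓔 𝓕)

{-# OPTIONS --safe #-}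

-- Push the flow of probability of a scheduler σ on 𝓔 forward along f.  Each fibre of f is finite, and the mass entering
-- the fibre of β leaves it along the events extending β, since stuttering steps have labels below δ and keep the
-- state fixed; normalising this flow gives the weights of a scheduler τ on 𝓕.  A maximal trace of 𝓔 whose image
-- is only weakly maximal is first continued by δ-labelled events of 𝓕.
--
-- A scheduler does not see the initial state, so conditioning on the runs of σ from s alone would leave τ without control
-- from the other states.  Instead τ is built from the initial measure δ_s + η, of full support: then Σ_s′ p(s′) τ_s′ =
-- Σ_s′ p(s′) σ_s′, all τ_s′ have mass 1, and τ_s → σ_s as η → 0, which is enough because ⟦ 𝓕 ⟧ s is closed.

module Submission where

open import Defs
open import Axiom.ExcludedMiddle using (ExcludedMiddle)
open import Data.Bool.Base using (true; false; if_then_else_)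
open import Data.Fin.Base using (Fin; zero; suc)
open import Data.Fin.Properties using (_≟_)
open import Data.List.Base
  using (List; []; _∷_; _++_; concatMap; deduplicate; filter; foldr; initLast; length; map; _∷ʳ′_)
open import Data.List.Membership.Propositional using (_∈_; _∉_; lose)
open import Data.List.Membership.Propositional.Properties
  using (∈-++⁺ˡ; ∈-++⁺ʳ; ∈-++⁻; ∈-concatMap⁺; ∈-deduplicate⁺; ∈-filter⁺; ∈-filter⁻; ∈-map⁺; ∈-map⁻; ∈-∃++)
open import Data.List.Properties
  using (++-assoc; ++-cancelʳ; ++-conicalʳ; ++-identityʳ; length-++; ∷-injectiveˡ; ∷-injectiveʳ; ∷ʳ-injectiveʳ)
open import Data.List.Relation.Unary.All as All using (All; []; _∷_)
import Data.List.Relation.Unary.All.Properties as All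
open import Data.List.Relation.Unary.AllPairs using ([]; _∷_)
open import Data.List.Relation.Unary.Any using (here; there)
open import Data.List.Relation.Unary.Unique.DecPropositional.Properties using (deduplicate-!)
open import Data.List.Relation.Unary.Unique.Propositional using (Unique)
import Data.List.Relation.Unary.Unique.Propositional.Properties as Unique
open import Data.Maybe.Base using (Maybe; just; nothing)
open import Data.Maybe.Properties using (just-injective)
open import Data.Nat.Base as ℕ using (ℕ; zero; suc)
import Data.Nat.Properties as ℕ
open import Data.Product.Base using (∃; ∃-syntax; Σ-syntax; _×_; _,_; proj₁; proj₂)
open import Data.Sum.Base using (_⊎_; inj₁; inj₂)
open import Data.Unit.Polymorphic.Base using (⊤)
open import Data.Vec.Functional using (Vector)
open import Function.Base using (_∘_; case_of_)
open import Level using (Level; 0ℓ; _⊔_)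
open import Relation.Binary.Bundles using (Poset)
open import Relation.Binary.PropositionalEquality as ≡ using (_≡_; _≢_)
open import Relation.Binary.Structures using (IsTotalOrder)
open import Relation.Nullary.Decidable
  using (Dec; does; yes; no; True; toWitness; fromWitness; recompute)
open import Relation.Nullary.Negation using (¬_; contradiction)
open import Relation.Unary using (Pred; Satisfiable; Empty)

-- Event sets may be infinite, so a run may have infinitely many children and every flow identity is
-- about suprema of finite partial sums. The proof therefore regroups non-negative families by
-- comparing upper bounds. Only the fibres of `f` are finite: this keeps the measure of a fibre
-- finite, so that the mass that stutters inside it can be subtracted, and it reduces membership in
-- a label to a convex combination of finitely many points. `Source` abstracts from 𝓔: steps of 𝓔
-- and the events completing a weakly maximal image become nodes of one tree whose childless nodes
-- lie over maximal traces of 𝓕, and the scheduler is built from that tree alone. The assumption on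
-- the empty traces fills a gap that `f-maximal` leaves. If 𝓔 has no events, its only outcome from
-- `s` is the point distribution at `s`, and the empty map is a t-simulation into an 𝓕 with a single
-- event whose label omits that distribution; the inclusion then fails.

module Summation (em : ∀ {ℓ} → ExcludedMiddle ℓ) (ℝ : CompleteOrderedField) where

  open CompleteOrderedField ℝ hiding (zero)
  open IsTotalOrder isTotalOrder public
    using (total; antisym; isPartialOrder; ≤-respˡ-≈; ≤-respʳ-≈)
    renaming (refl to ≤-refl; trans to ≤-trans; reflexive to ≤-reflexive)
  open import Algebra.Properties.Semiring.Sum semiring public
    using (sum; sum-cong-≋; ∑-distrib-+; ∑-comm; *-distribˡ-sum; *-distribʳ-sum; sum-replicate-zero)
  open import Algebra.Properties.CommutativeSemigroup +-commutativeSemigroup public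
    using () renaming (interchange to +-interchange; x∙yz≈y∙xz to +-swap)

  -- Arithmetic of the ordered field.

  ≤-poset : Poset 0ℓ 0ℓ 0ℓ
  ≤-poset = record { isPartialOrder = isPartialOrder }

  module ≤-Reasoning where
    open import Relation.Binary.Reasoning.PartialOrder ≤-poset public
      hiding (step-<; begin-strict_; begin-contradiction_)

  +-mono-≤ : ∀ {x y z w} → x ≤ y → z ≤ w → x + z ≤ y + w
  +-mono-≤ {x} {y} {z} {w} x≤y z≤w = ≤-trans (+-monoˡ-≤ z x≤y)
    (≤-respˡ-≈ (+-comm z y) (≤-respʳ-≈ (+-comm w y) (+-monoˡ-≤ y z≤w)))

  x+y-y≈x : ∀ x y → (x + y) - y ≈ x
  x+y-y≈x x y = trans (+-assoc x y (- y)) (trans (+-congˡ (-‿inverseʳ y)) (+-identityʳ x))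

  x-y+y≈x : ∀ x y → (x - y) + y ≈ x
  x-y+y≈x x y = trans (+-assoc x (- y) y) (trans (+-congˡ (-‿inverseˡ y)) (+-identityʳ x))

  +-cancelʳ-≤ : ∀ z {x y} → x + z ≤ y + z → x ≤ y
  +-cancelʳ-≤ z {x} {y} p = ≤-respˡ-≈ (x+y-y≈x x z) (≤-respʳ-≈ (x+y-y≈x y z) (+-monoˡ-≤ (- z) p))

  +-cancelˡ-≤ : ∀ z {x y} → z + x ≤ z + y → x ≤ y
  +-cancelˡ-≤ z p = +-cancelʳ-≤ z (≤-respˡ-≈ (+-comm z _) (≤-respʳ-≈ (+-comm z _) p))

  +-cancelʳ-≈ : ∀ z {x y} → x + z ≈ y + z → x ≈ y
  +-cancelʳ-≈ z p = antisym (+-cancelʳ-≤ z (≤-reflexive p)) (+-cancelʳ-≤ z (≤-reflexive (sym p)))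

  ≤⇒0≤- : ∀ {x y} → x ≤ y → 0# ≤ y - x
  ≤⇒0≤- {x} {y} p = ≤-respˡ-≈ (-‿inverseʳ x) (+-monoˡ-≤ (- x) p)

  x+y≤z⇒x≤z-y : ∀ {x y z} → x + y ≤ z → x ≤ z - y
  x+y≤z⇒x≤z-y {x} {y} p = ≤-respˡ-≈ (x+y-y≈x x y) (+-monoˡ-≤ (- y) p)

  x≤z-y⇒x+y≤z : ∀ {x y z} → x ≤ z - y → x + y ≤ z
  x≤z-y⇒x+y≤z {x} {y} {z} p = ≤-respʳ-≈ (x-y+y≈x z y) (+-monoˡ-≤ y p)

  x≤y+z⇒x-y≤z : ∀ {x y z} → x ≤ y + z → x - y ≤ z
  x≤y+z⇒x-y≤z {x} {y} {z} p = ≤-respʳ-≈ (x+y-y≈x z y) (+-monoˡ-≤ (- y) (≤-respʳ-≈ (+-comm y z) p))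

  +-nonNeg : ∀ {x y} → 0# ≤ x → 0# ≤ y → 0# ≤ x + y
  +-nonNeg p q = ≤-respˡ-≈ (+-identityˡ 0#) (+-mono-≤ p q)

  x≤x+y : ∀ {x y} → 0# ≤ y → x ≤ x + y
  x≤x+y p = ≤-respˡ-≈ (+-identityʳ _) (+-mono-≤ ≤-refl p)

  x≤y+x : ∀ {x y} → 0# ≤ y → x ≤ y + x
  x≤y+x p = ≤-respˡ-≈ (+-identityˡ _) (+-mono-≤ p ≤-refl)

  *-monoˡ-≤ : ∀ {z x y} → 0# ≤ z → x ≤ y → z * x ≤ z * y
  *-monoˡ-≤ {z} {x} {y} 0≤z x≤y = ≤-respˡ-≈ (+-identityˡ _) (≤-respʳ-≈ eq (+-monoˡ-≤ (z * x) (*-nonNeg 0≤z (≤⇒0≤- x≤y))))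
    where
    eq : z * (y - x) + z * x ≈ z * y
    eq = trans (sym (distribˡ z (y - x) x)) (*-congˡ (x-y+y≈x y x))

  open import Algebra.Properties.Ring ring using (-‿distribˡ-*; -‿distribʳ-*; -‿involutive)

  x*x-nonNeg : ∀ x → 0# ≤ x * x
  x*x-nonNeg x with total 0# x
  ... | inj₁ p = *-nonNeg p p
  ... | inj₂ p = ≤-respʳ-≈ eq (*-nonNeg q q)
    where
    q : 0# ≤ - x
    q = ≤-respʳ-≈ (+-identityˡ (- x)) (≤⇒0≤- p)
    eq : - x * - x ≈ x * x
    eq = trans (sym (-‿distribˡ-* x (- x))) (trans (-‿cong (sym (-‿distribʳ-* x x))) (-‿involutive (x * x)))

  0≤1 : 0# ≤ 1#
  0≤1 = ≤-respʳ-≈ (*-identityˡ 1#) (x*x-nonNeg 1#)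

  -- The inverse `y` equals `x * (y * y)`, a product of `x` and a square.
  inverse⁺ : ∀ {x} → 0# ≤ x → ¬ (x ≈ 0#) → ∃[ y ] 0# ≤ y × x * y ≈ 1#
  inverse⁺ {x} 0≤x x≉0 with y , xy≈1 ← inverse x x≉0 = y , ≤-respʳ-≈ eq (*-nonNeg 0≤x (x*x-nonNeg y)) , xy≈1
    where
    eq : x * (y * y) ≈ y
    eq = trans (sym (*-assoc x y y)) (trans (*-congʳ xy≈1) (*-identityˡ y))

  sum-mono-≤ : ∀ {k} {f g : Vector Carrier k} → (∀ i → f i ≤ g i) → sum f ≤ sum g
  sum-mono-≤ {zero}  p = ≤-refl
  sum-mono-≤ {suc k} p = +-mono-≤ (p zero) (sum-mono-≤ (p ∘ suc))

  sum-nonNeg : ∀ {k} {f : Vector Carrier k} → (∀ i → 0# ≤ f i) → 0# ≤ sum f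
  sum-nonNeg {zero}  p = ≤-refl
  sum-nonNeg {suc k} p = +-nonNeg (p zero) (sum-nonNeg (p ∘ suc))

  ≤-sum : ∀ {k} {f : Vector Carrier k} → (∀ i → 0# ≤ f i) → ∀ i → f i ≤ sum f
  ≤-sum p zero    = x≤x+y (sum-nonNeg (p ∘ suc))
  ≤-sum p (suc i) = ≤-trans (≤-sum (p ∘ suc) i) (x≤y+x (p zero))

  sum-zero : ∀ {k} {f : Vector Carrier k} → (∀ i → f i ≈ 0#) → sum f ≈ 0#
  sum-zero {k} p = trans (sum-cong-≋ p) (sum-replicate-zero k)

  -- Finite sums over lists.

  private variable
    a b p q : Level
    A : Set a
    B : Set b
    P : Pred A p
    Q : Pred B q
    g h : A → Carrier
    l m : List A
    v w : Carrier

  Σₗ : (A → Carrier) → List A → Carrier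
  Σₗ g = foldr (λ a acc → g a + acc) 0#

  Σₗ-cong : ∀ l → (∀ {a} → a ∈ l → g a ≈ h a) → Σₗ g l ≈ Σₗ h l
  Σₗ-cong []      eq = refl
  Σₗ-cong (x ∷ l) eq = +-cong (eq (here ≡.refl)) (Σₗ-cong l (eq ∘ there))

  Σₗ-mono : ∀ l → (∀ {a} → a ∈ l → g a ≤ h a) → Σₗ g l ≤ Σₗ h l
  Σₗ-mono []      le = ≤-refl
  Σₗ-mono (x ∷ l) le = +-mono-≤ (le (here ≡.refl)) (Σₗ-mono l (le ∘ there))

  Σₗ-zero : ∀ l → (∀ {a} → a ∈ l → g a ≈ 0#) → Σₗ g l ≈ 0#
  Σₗ-zero []      eq = refl
  Σₗ-zero (x ∷ l) eq = trans (+-cong (eq (here ≡.refl)) (Σₗ-zero l (eq ∘ there))) (+-identityˡ 0#)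

  Σₗ-nonNeg : ∀ l → (∀ {a} → a ∈ l → 0# ≤ g a) → 0# ≤ Σₗ g l
  Σₗ-nonNeg []      le = ≤-refl
  Σₗ-nonNeg (x ∷ l) le = +-nonNeg (le (here ≡.refl)) (Σₗ-nonNeg l (le ∘ there))

  Σₗ-++ : ∀ (g : A → Carrier) l m → Σₗ g (l ++ m) ≈ Σₗ g l + Σₗ g m
  Σₗ-++ g []      m = sym (+-identityˡ _)
  Σₗ-++ g (x ∷ l) m = trans (+-congˡ (Σₗ-++ g l m)) (sym (+-assoc _ _ _))

  Σₗ-+ : ∀ (g h : A → Carrier) l → Σₗ (λ a → g a + h a) l ≈ Σₗ g l + Σₗ h l
  Σₗ-+ g h []      = sym (+-identityˡ _)
  Σₗ-+ g h (x ∷ l) = trans (+-congˡ (Σₗ-+ g h l)) (+-interchange _ _ _ _)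

  Σₗ-* : ∀ c (g : A → Carrier) l → Σₗ (λ a → c * g a) l ≈ c * Σₗ g l
  Σₗ-* c g []      = sym (zeroʳ c)
  Σₗ-* c g (x ∷ l) = trans (+-congˡ (Σₗ-* c g l)) (sym (distribˡ c _ _))

  Σₗ-sum : ∀ {k} (G : A → Vector Carrier k) l → Σₗ (λ a → sum (G a)) l ≈ sum λ u → Σₗ (λ a → G a u) l
  Σₗ-sum {k = k} G []      = sym (sum-replicate-zero k)
  Σₗ-sum         G (x ∷ l) = trans (+-congˡ (Σₗ-sum G l)) (sym (∑-distrib-+ (G x) _))

  Σₗ-map : ∀ (g : B → Carrier) (h : A → B) l → Σₗ g (map h l) ≈ Σₗ (g ∘ h) l
  Σₗ-map g h []      = refl
  Σₗ-map g h (x ∷ l) = +-congˡ (Σₗ-map g h l)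

  Σₗ-filter : ∀ {A : Set a} (g : A → Carrier) (P : Pred A p) l →
    Σₗ g l ≈ Σₗ g (filter (λ x → em {P = P x}) l) + Σₗ g (filter (λ x → em {P = ¬ P x}) l)
  Σₗ-filter g P [] = sym (+-identityˡ _)
  Σₗ-filter g P (x ∷ l) with em {P = P x} | em {P = ¬ P x}
  ... | yes px | yes ¬px = contradiction px ¬px
  ... | yes px | no  _   = trans (+-congˡ (Σₗ-filter g P l)) (sym (+-assoc _ _ _))
  ... | no ¬px | yes _   = trans (+-congˡ (Σₗ-filter g P l)) (+-swap _ _ _)
  ... | no ¬px | no ¬¬px = contradiction ¬px ¬¬px

  -- The head of `l` is cut out of `m` at one occurrence; as `l` has no repetitions, its tail still
  -- lies in what remains of `m`.
  Σₗ-⊆ : ∀ {A : Set a} {g : A → Carrier} {l m : List A} → Unique l → (∀ {x} → x ∈ l → x ∈ m) →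
         (∀ {x} → x ∈ m → 0# ≤ g x) → Σₗ g l ≤ Σₗ g m
  Σₗ-⊆ {m = m} [] l⊆m nonNeg = Σₗ-nonNeg m nonNeg
  Σₗ-⊆ {g = g} {l = x ∷ l} (x∉l ∷ uniq) l⊆m nonNeg with ys , zs , ≡.refl ← ∈-∃++ (l⊆m (here ≡.refl)) = begin
    g x + Σₗ g l                 ≤⟨ +-mono-≤ ≤-refl (Σₗ-⊆ uniq l⊆rest rest-nonNeg) ⟩
    g x + Σₗ g (ys ++ zs)        ≈⟨ +-congˡ (Σₗ-++ g ys zs) ⟩
    g x + (Σₗ g ys + Σₗ g zs)    ≈⟨ +-swap _ _ _ ⟩
    Σₗ g ys + (g x + Σₗ g zs)    ≈⟨ Σₗ-++ g ys (x ∷ zs) ⟨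
    Σₗ g (ys ++ x ∷ zs)          ∎
    where
    open ≤-Reasoning
    l⊆rest : ∀ {y} → y ∈ l → y ∈ ys ++ zs
    l⊆rest y∈l with ∈-++⁻ ys (l⊆m (there y∈l))
    ... | inj₁ y∈ys           = ∈-++⁺ˡ y∈ys
    ... | inj₂ (here ≡.refl)  = contradiction ≡.refl (All.lookup x∉l y∈l)
    ... | inj₂ (there y∈zs)   = ∈-++⁺ʳ ys y∈zs
    rest-nonNeg : ∀ {y} → y ∈ ys ++ zs → 0# ≤ g y
    rest-nonNeg y∈ with ∈-++⁻ ys y∈
    ... | inj₁ y∈ys = nonNeg (∈-++⁺ˡ y∈ys)
    ... | inj₂ y∈zs = nonNeg (∈-++⁺ʳ ys (there y∈zs))

  ≤-Σₗ : ∀ {A : Set a} {g : A → Carrier} {l : List A} {x} → x ∈ l → (∀ {x} → x ∈ l → 0# ≤ g x) → g x ≤ Σₗ g l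
  ≤-Σₗ x∈l nonNeg = ≤-respˡ-≈ (+-identityʳ _) (Σₗ-⊆ ([] ∷ []) (λ { (here ≡.refl) → x∈l }) nonNeg)

  Σₗ-≋ : ∀ {A : Set a} {g : A → Carrier} {l m : List A} → Unique l → Unique m →
         (∀ {x} → x ∈ l → x ∈ m) → (∀ {x} → x ∈ m → x ∈ l) →
         (∀ {x} → x ∈ m → 0# ≤ g x) → Σₗ g l ≈ Σₗ g m
  Σₗ-≋ ul um l⊆m m⊆l nonNeg = antisym (Σₗ-⊆ ul l⊆m nonNeg) (Σₗ-⊆ um m⊆l (nonNeg ∘ l⊆m))

  -- Sums over sets of any cardinality.

  -- The upper-bound half of `HasSum`, quantified over lists instead of over values equal to a
  -- partial sum. `HasSum P g v` then says that `v` is the least `c` with `Bounded P g c`.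
  Bounded : ∀ {A : Set a} → Pred A p → (A → Carrier) → Carrier → Set (a ⊔ p)
  Bounded P g c = ∀ l → Unique l → All P l → Σₗ g l ≤ c

  bounded : HasSum P g v → Bounded P g v
  bounded (ub , _) l u a = ub _ (l , u , a , refl)

  least : HasSum P g v → Bounded P g w → v ≤ w
  least (_ , lub) bd = lub _ λ _ (l , u , a , eq) → ≤-respˡ-≈ (sym eq) (bd l u a)

  hasSum : Bounded P g v → (∀ {c} → Bounded P g c → v ≤ c) → HasSum P g v
  hasSum bd lub = (λ _ (l , u , a , eq) → ≤-respˡ-≈ (sym eq) (bd l u a))
                , (λ c ub → lub λ l u a → ub _ (l , u , a , refl))

  bounded-≤ : v ≤ w → Bounded P g v → Bounded P g w
  bounded-≤ v≤w bd l u a = ≤-trans (bd l u a) v≤w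

  -- Holding `d` fixed and moving it across the inequality allows one supremum to be taken at a time
  -- when several families are summed together.
  least-+ : ∀ {v d c} → HasSum P g v → (∀ l → Unique l → All P l → Σₗ g l + d ≤ c) → v + d ≤ c
  least-+ hs bd = x≤z-y⇒x+y≤z (least hs λ l u a → x+y≤z⇒x≤z-y (bd l u a))

  hasSum-≈ : v ≈ w → HasSum P g v → HasSum P g w
  hasSum-≈ v≈w hs = hasSum (bounded-≤ (≤-reflexive v≈w) (bounded hs)) λ bd → ≤-respˡ-≈ v≈w (least hs bd)

  hasSum-unique : HasSum P g v → HasSum P g w → v ≈ w
  hasSum-unique hv hw = antisym (least hv (bounded hw)) (least hw (bounded hv))

  -- Families with the same upper bounds have the same least one, so an equality of infinite sums
  -- splits into two implications between finite estimates.
  hasSum-transfer : (∀ {c} → Bounded P g c → Bounded Q h c) → (∀ {c} → Bounded Q h c → Bounded P g c) →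
                    HasSum P g v → HasSum Q h v
  hasSum-transfer to from hs = hasSum (to (bounded hs)) λ bd → least hs (from bd)

  hasSum-cong : ∀ {A : Set a} {P : Pred A p} {Q : Pred A q} {g h : A → Carrier} {v} →
                (∀ {x} → P x → Q x) → (∀ {x} → Q x → P x) →
                (∀ {x} → P x → g x ≈ h x) → HasSum P g v → HasSum Q h v
  hasSum-cong {P = P} {Q} {g} {h} P⇒Q Q⇒P g≈h = hasSum-transfer
    (λ bd l u a → ≤-respˡ-≈ (Σₗ-cong l λ x∈l → g≈h (Q⇒P (All.lookup a x∈l))) (bd l u (All.map Q⇒P a)))
    (λ bd l u a → ≤-respˡ-≈ (Σₗ-cong l λ x∈l → sym (g≈h (All.lookup a x∈l))) (bd l u (All.map P⇒Q a)))

  -- complete wants a predicate of level 0, so the partial sums are resized by deciding them.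
  hasSum-exists : Bounded P g w → ∃ (HasSum P g)
  hasSum-exists {P = P} {g = g} {w = w} bd = proj₁ sup , hasSum
      (λ l u a → proj₁ (proj₂ sup) _ (fromWitness (l , u , a , refl)))
      (λ bd′ → lub _ λ x S → let l , u , a , eq = toWitness S in ≤-respˡ-≈ (sym eq) (bd′ l u a))
    where
    PartialSum : Pred Carrier _
    PartialSum x = ∃[ l ] Unique l × All P l × x ≈ Σₗ g l
    S : Pred Carrier 0ℓ
    S x = True (em {P = PartialSum x})
    sup : ∃ (IsLub S)
    sup = complete S (0# , fromWitness ([] , [] , [] , refl))
      (w , λ x s → let l , u , a , eq = toWitness s in ≤-respˡ-≈ (sym eq) (bd l u a))
    lub = proj₂ (proj₂ sup)

  union : ∀ {A : Set a} (l m : List A) → List A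
  union l m = l ++ filter (λ x → em {P = x ∉ l}) m

  union-unique : ∀ {A : Set a} {l m : List A} → Unique l → Unique m → Unique (union l m)
  union-unique {l = l} {m} ul um = Unique.++⁺ ul (Unique.filter⁺ _ um)
    λ (x∈l , x∈m′) → proj₂ (∈-filter⁻ (λ x → em {P = x ∉ l}) {xs = m} x∈m′) x∈l

  union-All : ∀ {A : Set a} {P : Pred A p} {l m : List A} → All P l → All P m → All P (union l m)
  union-All al am = All.++⁺ al (All.filter⁺ _ am)

  ∈-unionʳ : ∀ {A : Set a} {l m : List A} {x} → x ∈ m → x ∈ union l m
  ∈-unionʳ {l = l} {x = x} x∈m with em {P = x ∈ l}
  ... | yes x∈l = ∈-++⁺ˡ x∈l
  ... | no  x∉l = ∈-++⁺ʳ l (∈-filter⁺ _ x∈m x∉l)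

  -- Near-optimal partial sums of `g` and `h` may live on different lists; non-negativity lets both
  -- be enlarged to the union, where they add up.
  hasSum-+ : (∀ {x} → P x → 0# ≤ g x) → (∀ {x} → P x → 0# ≤ h x) →
             HasSum P g v → HasSum P h w → HasSum P (λ x → g x + h x) (v + w)
  hasSum-+ {P = P} {g = g} {h = h} g≥0 h≥0 hg hh = hasSum
    (λ l u a → ≤-respˡ-≈ (sym (Σₗ-+ g h l)) (+-mono-≤ (bounded hg l u a) (bounded hh l u a)))
    λ {c} bd → least-+ hg λ l ul al → ≤-respˡ-≈ (+-comm _ _) (least-+ hh λ m um am →
      let open ≤-Reasoning
          all = union-All {P = P} {l = l} {m = m} al am in begin
      Σₗ h m + Σₗ g l                     ≤⟨ +-mono-≤ (Σₗ-⊆ um (∈-unionʳ {l = l} {m = m}) (h≥0 ∘ All.lookup all))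
                                                      (Σₗ-⊆ ul (∈-++⁺ˡ {xs = l}) (g≥0 ∘ All.lookup all)) ⟩
      Σₗ h (union l m) + Σₗ g (union l m) ≈⟨ +-comm _ _ ⟩
      Σₗ g (union l m) + Σₗ h (union l m) ≈⟨ Σₗ-+ g h (union l m) ⟨
      Σₗ (λ x → g x + h x) (union l m)    ≤⟨ bd _ (union-unique ul um) all ⟩
      c                                   ∎)

  hasSum-0 : HasSum P (λ _ → 0#) 0#
  hasSum-0 = hasSum (λ l _ _ → ≤-reflexive (Σₗ-zero l λ _ → refl)) λ bd → bd [] [] []

  hasSum-* : ∀ {c} → 0# ≤ c → HasSum P g v → HasSum P (λ x → c * g x) (c * v)
  hasSum-* {P = P} {g = g} {v = v} {c} 0≤c hs with em {P = c ≈ 0#}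
  ... | yes c≈0 = hasSum-≈ (sym (trans (*-congʳ c≈0) (zeroˡ v)))
          (hasSum-cong (λ p → p) (λ p → p) (λ _ → sym (trans (*-congʳ c≈0) (zeroˡ _))) hasSum-0)
  ... | no c≉0 with d , 0≤d , cd≈1 ← inverse⁺ 0≤c c≉0 = hasSum
          (λ l u a → ≤-respˡ-≈ (sym (Σₗ-* c g l)) (*-monoˡ-≤ 0≤c (bounded hs l u a)))
          λ {e} bd → ≤-respʳ-≈ (cd* e) (*-monoˡ-≤ 0≤c (least hs λ l u a →
            ≤-respˡ-≈ (dc* _) (*-monoˡ-≤ 0≤d (≤-respˡ-≈ (Σₗ-* c g l) (bd l u a)))))
    where
    cd* : ∀ e → c * (d * e) ≈ e
    cd* e = trans (sym (*-assoc c d e)) (trans (*-congʳ cd≈1) (*-identityˡ e))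
    dc* : ∀ e → d * (c * e) ≈ e
    dc* e = trans (sym (*-assoc d c e)) (trans (*-congʳ (trans (*-comm d c) cd≈1)) (*-identityˡ e))

  hasSum-sum : ∀ {A : Set a} {P : Pred A p} {k} {G : A → Vector Carrier k} {V : Vector Carrier k} →
               (∀ {x} → P x → ∀ i → 0# ≤ G x i) → (∀ i → HasSum P (λ x → G x i) (V i)) →
               HasSum P (λ x → sum (G x)) (sum V)
  hasSum-sum {k = zero}  G≥0 hs = hasSum-0
  hasSum-sum {k = suc k} G≥0 hs = hasSum-+ (λ p → G≥0 p zero) (λ p → sum-nonNeg (G≥0 p ∘ suc))
    (hs zero) (hasSum-sum (λ p → G≥0 p ∘ suc) (hs ∘ suc))

  hasSum-finite : Unique l → (∀ {x} → P x → x ∈ l) → (∀ {x} → x ∈ l → P x) → (∀ {x} → P x → 0# ≤ g x) →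
                  HasSum P g (Σₗ g l)
  hasSum-finite {l = l} ul P⇒∈ ∈⇒P nonNeg = hasSum
    (λ m um am → Σₗ-⊆ um (P⇒∈ ∘ All.lookup am) (nonNeg ∘ ∈⇒P))
    λ bd → bd l ul (All.tabulate ∈⇒P)

  hasSum-singleton : ∀ {A : Set a} {P : Pred A p} {g : A → Carrier} {x} → P x → (∀ {y} → P y → y ≡ x) →
                     0# ≤ g x → HasSum P g (g x)
  hasSum-singleton {g = g} {x = x} px uniq 0≤gx = hasSum-≈ (+-identityʳ _)
    (hasSum-finite ([] ∷ []) (λ py → here (uniq py)) (λ { (here ≡.refl) → px })
      (λ py → ≡.subst (λ z → 0# ≤ g z) (≡.sym (uniq py)) 0≤gx))

  hasSum-support : ∀ {A : Set a} {P : Pred A p} {S : Pred A q} {g : A → Carrier} {v} →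
                   (∀ {x} → P x → ¬ S x → g x ≈ 0#) → HasSum (λ x → P x × S x) g v → HasSum P g v
  hasSum-support {P = P} {S} {g} g≈0 hs = hasSum
    (λ l u a → ≤-respˡ-≈ (sym (trans (Σₗ-filter g S l) (trans (+-congˡ (Σₗ-zero (filter (λ x → em {P = ¬ S x}) l)
        λ x∈ → let x∈l , ¬s = ∈-filter⁻ (λ x → em {P = ¬ S x}) {xs = l} x∈ in g≈0 (All.lookup a x∈l) ¬s)) (+-identityʳ _))))
      (bounded hs _ (Unique.filter⁺ _ u) (All.zip (All.filter⁺ _ a , All.all-filter _ l))))
    λ bd → least hs λ l u a → bd l u (All.map proj₁ a)

  hasSum-empty : ∀ {A : Set a} {P : Pred A p} {g : A → Carrier} {v} → (∀ x → ¬ P x) → HasSum P g v → v ≈ 0#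
  hasSum-empty ¬P hs = antisym (least hs λ { [] _ _ → ≤-refl ; (x ∷ _) _ (px ∷ _) → contradiction px (¬P x) })
                               (bounded hs [] [] [])

  -- P is the disjoint union of the fibres Fib b over b ∈ Q.
  record Fibration {A : Set a} {B : Set b} (P : Pred A p) (Q : Pred B q) {r} (Fib : B → Pred A r) : Set (a ⊔ b ⊔ p ⊔ q ⊔ r) where
    field
      cover    : ∀ {x} → P x → ∃[ y ] Q y × Fib y x
      total⁻   : ∀ {x y} → Q y → Fib y x → P x
      disjoint : ∀ {x y z} → Fib y x → Fib z x → y ≡ z

  module _ {A : Set a} {B : Set b} {P : Pred A p} {Q : Pred B q} {r} {Fib : B → Pred A r}
           (fib : Fibration P Q Fib) {g : A → Carrier} {k : B → Carrier} where
    open Fibration fib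

    Σₗ-fibres : (∀ {y} → Q y → Bounded (Fib y) g (k y)) → ∀ l → Unique l → All P l →
                (Q′ : List B) → Unique Q′ → All Q Q′ → (∀ {x y} → x ∈ l → Q y → Fib y x → y ∈ Q′) →
                Σₗ g l ≤ Σₗ k Q′
    Σₗ-fibres bd []      u a []       uQ aQ cov = ≤-refl
    Σₗ-fibres bd (x ∷ l) u (px ∷ _) [] uQ aQ cov with y , qy , fy ← cover px with () ← cov (here ≡.refl) qy fy
    Σₗ-fibres bd l       u a (y ∷ ys) (y∉ys ∷ uQ) (qy ∷ aQ) cov = ≤-respˡ-≈ (sym (Σₗ-filter g (Fib y) l))
      (+-mono-≤ (bd qy _ (Unique.filter⁺ _ u) (All.all-filter _ l))
                (Σₗ-fibres bd _ (Unique.filter⁺ _ u) (All.filter⁺ _ a) ys uQ aQ cov′))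
      where
      cov′ : ∀ {x z} → x ∈ filter (λ x → em {P = ¬ Fib y x}) l → Q z → Fib z x → z ∈ ys
      cov′ x∈ qz fz with x∈l , ¬fy ← ∈-filter⁻ (λ x → em {P = ¬ Fib y x}) {xs = l} x∈ with cov x∈l qz fz
      ... | here ≡.refl = contradiction fz ¬fy
      ... | there z∈ys  = z∈ys

    images : ∀ l → All P l → ∃[ Q′ ] Unique Q′ × All Q Q′ × (∀ {x y} → x ∈ l → Q y → Fib y x → y ∈ Q′)
    images [] [] = [] , [] , [] , λ ()
    images (x ∷ l) (px ∷ a) with images l a | cover px
    ... | Q′ , u , aQ , cov | y , qy , fy = union (y ∷ []) Q′ , union-unique ([] ∷ []) u , union-All (qy ∷ []) aQ , cov′
      where
      cov′ : ∀ {x′ z} → x′ ∈ x ∷ l → Q z → Fib z x′ → z ∈ union (y ∷ []) Q′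
      cov′ (here ≡.refl) qz fz = here (disjoint fz fy)
      cov′ (there x∈l)   qz fz = ∈-unionʳ {l = y ∷ []} {m = Q′} (cov x∈l qz fz)

    -- A finite list meets only finitely many fibres, collected by `images`, and its part in the
    -- fibre of `y` contributes at most `k y`.
    bounded-total : ∀ {c} → (∀ {y} → Q y → Bounded (Fib y) g (k y)) → Bounded Q k c → Bounded P g c
    bounded-total bd bdQ l u a with Q′ , uQ , aQ , cov ← images l a =
      ≤-trans (Σₗ-fibres bd l u a Q′ uQ aQ cov) (bdQ Q′ uQ aQ)

    -- Each `k y` is replaced by a finite partial sum in its fibre, one fibre at a time. The lists
    -- chosen so far are gathered in `m`; `avoid` keeps `m` off the fibres still to come, so the
    -- gathered list never repeats an element.
    bounded-base : ∀ {c} → (∀ {y} → Q y → HasSum (Fib y) g (k y)) → Bounded P g c → Bounded Q k c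
    bounded-base {c} hs bd l u a = ≤-respˡ-≈ (+-identityʳ _) (go l u a [] [] [] λ _ ())
      where
      go : ∀ l → Unique l → All Q l → ∀ m → Unique m → All P m → (∀ {y x} → y ∈ l → x ∈ m → ¬ Fib y x) →
           Σₗ k l + Σₗ g m ≤ c
      go []       u        a         m um am avoid = ≤-respˡ-≈ (sym (+-identityˡ _)) (bd m um am)
      go (y ∷ ys) (y∉ys ∷ u) (qy ∷ a) m um am avoid = ≤-respˡ-≈ (sym (+-assoc _ _ _)) (least-+ (hs qy) λ m′ um′ am′ →
        ≤-respˡ-≈ (trans (+-congˡ (Σₗ-++ g m′ m)) (+-swap _ _ _))
          (go ys u a (m′ ++ m)
            (Unique.++⁺ um′ um λ (x∈m′ , x∈m) → avoid (here ≡.refl) x∈m (All.lookup am′ x∈m′))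
            (All.++⁺ (All.map (total⁻ qy) am′) am)
            λ {z} z∈ys x∈ fz → avoid′ z∈ys (∈-++⁻ m′ x∈) fz am′))
        where
        avoid′ : ∀ {z x m′} → z ∈ ys → x ∈ m′ ⊎ x ∈ m → Fib z x → All (Fib y) m′ → _
        avoid′ z∈ys (inj₁ x∈m′) fz am′ = All.lookup y∉ys z∈ys (disjoint (All.lookup am′ x∈m′) fz)
        avoid′ z∈ys (inj₂ x∈m)  fz am′ = avoid (there z∈ys) x∈m fz

    hasSum-total : ∀ {v} → (∀ {y} → Q y → HasSum (Fib y) g (k y)) → HasSum Q k v → HasSum P g v
    hasSum-total hs = hasSum-transfer (bounded-total (λ qy → bounded (hs qy))) (bounded-base hs)

    hasSum-base : ∀ {v} → (∀ {y} → Q y → HasSum (Fib y) g (k y)) → HasSum P g v → HasSum Q k v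
    hasSum-base hs = hasSum-transfer (bounded-base hs) (bounded-total (λ qy → bounded (hs qy)))

  module _ {B : Set b} {Q : Pred (Maybe B) q} {k : Maybe B → Carrier}
           (0≤k : 0# ≤ k nothing) (k≥0 : ∀ {y} → Q (just y) → 0# ≤ k (just y)) where

    private
      justs : ∀ l → Unique l → All Q l →
              ∃[ m ] Unique m × All (Q ∘ just) m × (∀ {y} → just y ∈ l → y ∈ m) × (∀ {y} → y ∈ m → just y ∈ l)
      justs [] [] [] = [] , [] , [] , (λ ()) , λ ()
      justs (nothing ∷ l) (_ ∷ u) (_ ∷ a) with m , um , am , to , from ← justs l u a =
        m , um , am , (λ { (there y∈l) → to y∈l }) , there ∘ from
      justs (just y ∷ l) (y∉ ∷ u) (qy ∷ a) with m , um , am , to , from ← justs l u a =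
        y ∷ m , All.tabulate (λ z∈m y≡z → All.lookup y∉ (from z∈m) (≡.cong just y≡z)) ∷ um , qy ∷ am ,
        (λ { (here ≡.refl) → here ≡.refl ; (there z∈l) → there (to z∈l) }) ,
        (λ { (here ≡.refl) → here ≡.refl ; (there z∈m) → there (from z∈m) })

    bounded-nothing : ∀ {c} → Bounded (Q ∘ just) (k ∘ just) c → Bounded Q k (k nothing + c)
    bounded-nothing bd l u a with m , um , am , to , from ← justs l u a =
      ≤-trans (Σₗ-⊆ {m = nothing ∷ map just m} u ⊆m nonNeg)
        (+-mono-≤ ≤-refl (≤-respˡ-≈ (sym (Σₗ-map k just m)) (bd m um am)))
      where
      ⊆m : ∀ {x} → x ∈ l → x ∈ nothing ∷ map just m
      ⊆m {nothing} _   = here ≡.refl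
      ⊆m {just y}  y∈l = there (∈-map⁺ just (to y∈l))
      nonNeg : ∀ {x} → x ∈ nothing ∷ map just m → 0# ≤ k x
      nonNeg (here ≡.refl) = 0≤k
      nonNeg (there x∈) with y , y∈m , ≡.refl ← ∈-map⁻ just x∈ = k≥0 (All.lookup am y∈m)

    -- Any list of `just` indices can be prolonged by `nothing`, which gives the upper bound;
    -- `bounded-nothing` gives leastness. It serves to take the stuttering mass off the mass leaving
    -- the nodes of a fibre.
    hasSum-just : ∀ {v} → Q nothing → HasSum Q k v → HasSum (Q ∘ just) (k ∘ just) (v - k nothing)
    hasSum-just q hs = hasSum
      (λ l u a → x+y≤z⇒x≤z-y (≤-respˡ-≈ (trans (+-congˡ (Σₗ-map k just l)) (+-comm _ _))
        (bounded hs (nothing ∷ map just l)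
          (All.map⁺ (All.universal (λ _ ()) l) ∷ Unique.map⁺ (λ { ≡.refl → ≡.refl }) u) (q ∷ All.map⁺ a))))
      λ bd → x≤y+z⇒x-y≤z (least hs (bounded-nothing bd))

-- Schedulers, masses of traces and outcomes.

module Schedules (em : ∀ {ℓ} → ExcludedMiddle ℓ) (ℝ : CompleteOrderedField) (n : ℕ) where

  open Programs ℝ n
  open CompleteOrderedField ℝ hiding (zero)
  open Summation em ℝ
  open Trace

  private
    indicator : ∀ {k} → Fin k → Fin k → Carrier
    indicator s u = if does (s ≟ u) then 1# else 0#

    indicator-sym : ∀ {k} (s u : Fin k) → indicator s u ≡ indicator u s
    indicator-sym zero    zero    = ≡.refl
    indicator-sym zero    (suc _) = ≡.refl
    indicator-sym (suc _) zero    = ≡.refl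
    indicator-sym (suc s) (suc u) = indicator-sym s u

    sum-indicator : ∀ {k} (f : Vector Carrier k) s → sum (λ u → f u * indicator s u) ≈ f s
    sum-indicator f zero    = trans (+-cong (*-identityʳ _) (sum-zero λ u → zeroʳ (f (suc u)))) (+-identityʳ _)
    sum-indicator f (suc s) = trans (+-cong (zeroʳ (f zero)) (sum-indicator (f ∘ suc) s)) (+-identityˡ _)

  sum-δʳ : ∀ (f : Point) s → sum (λ u → f u * δ[ s ] u) ≈ f s
  sum-δʳ = sum-indicator

  sum-δˡ : ∀ (f : Point) u → sum (λ s → f s * δ[ s ] u) ≈ f u
  sum-δˡ f u = trans (sum-cong-≋ λ s → *-congˡ (reflexive (indicator-sym s u))) (sum-indicator f u)

  sum-δ : ∀ s → sum δ[ s ] ≈ 1#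
  sum-δ s = trans (sum-cong-≋ λ u → sym (*-identityˡ (δ[ s ] u))) (sum-δʳ (λ _ → 1#) s)

  δ-nonNeg : ∀ s u → 0# ≤ δ[ s ] u
  δ-nonNeg s u with does (s ≟ u)
  ... | true  = 0≤1
  ... | false = ≤-refl

  module _ {𝓔 : IPBES} where
    open IPBES 𝓔

    suffix : ∀ γ {α} → IsTrace 𝓔 (γ ++ α) → IsTrace 𝓔 α
    suffix []      t = t
    suffix (_ ∷ γ) t = suffix γ (prefix t)

    extends⇒¬maximal : ∀ {α e} → IsTrace 𝓔 (e ∷ α) → ¬ IsMaximal 𝓔 α
    extends⇒¬maximal t (_ , max) with () ← max (_ ∷ []) t

    maximal-or-extends : ∀ {α} → IsTrace 𝓔 α → IsMaximal 𝓔 α ⊎ ∃[ e ] IsTrace 𝓔 (e ∷ α)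
    maximal-or-extends {α} t with em {P = ∃[ e ] IsTrace 𝓔 (e ∷ α)}
    ... | yes ext = inj₂ ext
    ... | no ¬ext = inj₁ (t , λ γ t′ → stuck γ t′)
      where
      stuck : ∀ γ → IsTrace 𝓔 (γ ++ α) → γ ≡ []
      stuck []      t′ = ≡.refl
      stuck (e ∷ γ) t′ with stuck γ (prefix t′)
      ... | ≡.refl = contradiction (e , t′) ¬ext

  module SchedulerProperties {𝓔 : IPBES} {σ : PreScheduler 𝓔} (isSched : IsScheduler 𝓔 σ) where
    open IPBES 𝓔

    weight : Trace 𝓔 → Event → Ω → Carrier
    weight α = proj₁ (proj₂ (isSched α))

    0≤weight : ∀ α e s → 0# ≤ weight α e s
    0≤weight α e s = proj₁ (proj₁ (proj₂ (proj₂ (isSched α))) e s)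

    kernel : ∀ α e (t : IsTrace 𝓔 (e ∷ events α)) s →
      (∃[ μ ] ⟨ lab e ⟩ s μ × σ α e t s ≋ weight α e s · μ) ⊎
      (Empty (⟨ lab e ⟩ s) × weight α e s ≈ 0# × σ α e t s ≋ 𝟎)
    kernel α e t s with cond ← proj₁ (proj₂ (proj₂ (proj₂ (isSched α)))) e t s | em {P = Satisfiable (⟨ lab e ⟩ s)}
    ... | yes sat = inj₁ (proj₁ cond sat)
    ... | no ¬sat = let ¬μ = λ μ μ∈ → ¬sat (μ , μ∈) in inj₂ (¬μ , proj₂ cond ¬μ)

    weight-sum : ∀ α {e} → IsTrace 𝓔 (e ∷ events α) → ∀ s →
                 HasSum (λ e → IsTrace 𝓔 (e ∷ events α)) (λ e → weight α e s) 1#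
    weight-sum α t = proj₂ (proj₂ (proj₂ (proj₂ (isSched α)))) (_ , t)

    0≤σ : ∀ α e (t : IsTrace 𝓔 (e ∷ events α)) s u → 0# ≤ σ α e t s u
    0≤σ α e t s = proj₁ (proj₁ (isSched α) e t s)

    sum-σ : ∀ α e (t : IsTrace 𝓔 (e ∷ events α)) s → sum (σ α e t s) ≈ weight α e s
    sum-σ α e t s with kernel α e t s
    ... | inj₁ (μ , μ∈ , eq) = trans (sum-cong-≋ eq) (trans (sym (*-distribˡ-sum (weight α e s) μ))
                                 (trans (*-congˡ (proj₂ (𝒫𝔻.dist (ℍ̄₁.at (lab e) s) μ∈))) (*-identityʳ _)))
    ... | inj₂ (_ , w≈0 , eq) = trans (sum-zero eq) (sym w≈0)

    0≤φ : ∀ s {α} (t : IsTrace 𝓔 α) u → 0# ≤ φ-list 𝓔 σ s α t u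
    0≤φ s empty u = δ-nonNeg s u
    0≤φ s (extend t x y z) u = sum-nonNeg λ v → *-nonNeg (0≤σ _ _ (extend t x y z) v u) (0≤φ s t v)

    mass : Ω → Trace 𝓔 → Carrier
    mass s α = sum (φ 𝓔 σ s α)

    mass-extend : ∀ s {α e} (t : IsTrace 𝓔 (e ∷ α)) → mass s ⟪ e ∷ α , t ⟫ ≈
                  sum λ v → weight ⟪ α , prefix t ⟫ e v * φ-list 𝓔 σ s α (prefix t) v
    mass-extend s {α} {e} t = begin-equality
      sum (λ u → sum λ v → σ α′ e t v u * φₛ v)   ≈⟨ ∑-comm (λ u v → σ α′ e t v u * φₛ v) ⟩
      sum (λ v → sum λ u → σ α′ e t v u * φₛ v)   ≈⟨ sum-cong-≋ (λ v → *-distribʳ-sum (φₛ v) (σ α′ e t v)) ⟨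
      sum (λ v → sum (σ α′ e t v) * φₛ v)         ≈⟨ sum-cong-≋ (λ v → *-congʳ (sum-σ α′ e t v)) ⟩
      sum (λ v → weight α′ e v * φₛ v)            ∎
      where
      open ≤-Reasoning
      α′ = ⟪ α , prefix t ⟫
      φₛ : Point
      φₛ v = φ-list 𝓔 σ s α (prefix t) v

    weights-bounded : ∀ s α → IsTrace 𝓔 (events α) →
                      Bounded (λ e → IsTrace 𝓔 (e ∷ events α)) (λ e → sum λ v → weight α e v * φ 𝓔 σ s α v) (mass s α)
    weights-bounded s α t []      u a = sum-nonNeg (0≤φ s t)
    -- The head of a non-empty list shows that `α` can be extended, which `weight-sum` demands; for
    -- a maximal `α` only the empty list occurs, hence a bound and not a sum.
    weights-bounded s α t (e ∷ l) u a@(t′ ∷ _) = begin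
      Σₗ (λ e → sum λ v → weight α e v * φₛ v) (e ∷ l)  ≈⟨ Σₗ-sum (λ e v → weight α e v * φₛ v) (e ∷ l) ⟩
      sum (λ v → Σₗ (λ e → weight α e v * φₛ v) (e ∷ l))
        ≈⟨ sum-cong-≋ (λ v → trans (Σₗ-cong {h = λ e → φₛ v * weight α e v} (e ∷ l) λ _ → *-comm _ _) (Σₗ-* (φₛ v) (λ e → weight α e v) (e ∷ l))) ⟩
      sum (λ v → φₛ v * Σₗ (λ e → weight α e v) (e ∷ l))
        ≤⟨ sum-mono-≤ (λ v → *-monoˡ-≤ (0≤φ s t v) (bounded (weight-sum α t′ v) (e ∷ l) u a)) ⟩
      sum (λ v → φₛ v * 1#)                             ≈⟨ sum-cong-≋ (λ v → *-identityʳ (φₛ v)) ⟩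
      sum φₛ                                            ∎
      where
      open ≤-Reasoning
      φₛ : Point
      φₛ = φ 𝓔 σ s α

    children-bounded : ∀ s α → IsTrace 𝓔 (events α) →
      Bounded (λ x → ∃[ e ] events x ≡ e ∷ events α × IsTrace 𝓔 (e ∷ events α)) (mass s) (mass s α)
    children-bounded s α t = bounded-total fibration (λ t′ → bounded (single t′)) (weights-bounded s α t)
      where
      fibration : Fibration (λ x → ∃[ e ] events x ≡ e ∷ events α × IsTrace 𝓔 (e ∷ events α))
                            (λ e → IsTrace 𝓔 (e ∷ events α)) (λ e x → events x ≡ e ∷ events α)
      fibration = record
        { cover    = λ (e , eq , t) → e , t , eq
        ; total⁻   = λ t eq → _ , eq , t
        ; disjoint = λ eq eq′ → ∷-injectiveˡ (≡.trans (≡.sym eq) eq′)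
        }
      single : ∀ {e} (t : IsTrace 𝓔 (e ∷ events α)) → HasSum (λ x → events x ≡ e ∷ events α) (mass s)
                 (sum λ v → weight α e v * φ 𝓔 σ s α v)
      single {e} t = hasSum-≈ (mass-extend s t) (hasSum-singleton {x = ⟪ e ∷ events α , t ⟫} ≡.refl
        (λ { {⟪ _ , _ ⟫} ≡.refl → ≡.refl }) (sum-nonNeg (0≤φ s t)))

    -- The traces at which a run cut off after k steps can stop.
    Cut : ℕ → Trace 𝓔 → Set₁
    Cut k α = (length (events α) ≡ k × IsTrace 𝓔 (events α)) ⊎ (length (events α) ℕ.< k × IsMaximal 𝓔 (events α))

    Cut-trace : ∀ {k α} → Cut k α → IsTrace 𝓔 (events α)
    Cut-trace (inj₁ (_ , t))     = t
    Cut-trace (inj₂ (_ , t , _)) = t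

    -- The two ways of passing from a cut at `k` to one at `suc k`. The length bound in `Stays`
    -- separates it from `Grows`. A maximal trace of length exactly `k` falls under the first case
    -- of `Cut k` but under the second of `Cut (suc k)`.
    Stays Grows : ℕ → Trace 𝓔 → Trace 𝓔 → Set₁
    Stays k α x = x ≡ α × IsMaximal 𝓔 (events x) × length (events x) ℕ.≤ k
    Grows k α x = (∃[ e ] events x ≡ e ∷ events α × IsTrace 𝓔 (e ∷ events α)) × length (events x) ≡ suc k

    Cut-fibration : ∀ k → Fibration (Cut (suc k)) (Cut k) (λ α x → Stays k α x ⊎ Grows k α x)
    Cut-fibration k = record { cover = cover ; total⁻ = total⁻ ; disjoint = disjoint }
      where
      cover : ∀ {x} → Cut (suc k) x → ∃[ y ] Cut k y × (Stays k y x ⊎ Grows k y x)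
      cover {⟪ e ∷ α , _ ⟫} (inj₁ (len , t)) =
        ⟪ α , prefix t ⟫ , inj₁ (ℕ.suc-injective len , prefix t) , inj₂ ((e , ≡.refl , t) , len)
      cover {x} (inj₂ (ℕ.s≤s len , max@(t , _))) with ℕ.m≤n⇒m<n∨m≡n len
      ... | inj₁ lt = x , inj₂ (lt , max) , inj₁ (≡.refl , max , len)
      ... | inj₂ eq = x , inj₁ (eq , t)   , inj₁ (≡.refl , max , len)
      total⁻ : ∀ {x y} → Cut k y → Stays k y x ⊎ Grows k y x → Cut (suc k) x
      total⁻ c (inj₁ (_ , max , len)) = inj₂ (ℕ.s≤s len , max)
      total⁻ c (inj₂ ((e , eq , t) , len)) = inj₁ (len , ≡.subst (IsTrace 𝓔) (≡.sym eq) t)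
      disjoint : ∀ {x y z} → Stays k y x ⊎ Grows k y x → Stays k z x ⊎ Grows k z x → y ≡ z
      disjoint (inj₁ (eq , _)) (inj₁ (eq′ , _)) = ≡.trans (≡.sym eq) eq′
      disjoint (inj₁ (_ , _ , len)) (inj₂ (_ , len′)) = contradiction (≡.subst (ℕ._≤ k) len′ len) ℕ.1+n≰n
      disjoint (inj₂ (_ , len′)) (inj₁ (_ , _ , len)) = contradiction (≡.subst (ℕ._≤ k) len′ len) ℕ.1+n≰n
      disjoint {y = ⟪ _ , _ ⟫} {⟪ _ , _ ⟫} (inj₂ ((_ , eq , _) , _)) (inj₂ ((_ , eq′ , _) , _))
        with ≡.refl ← ∷-injectiveʳ (≡.trans (≡.sym eq) eq′) = ≡.refl

    -- Deepening the cut by one replaces each of its traces by itself or by its children, whose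
    -- total mass is no larger; at depth zero only the empty trace is left.
    Cut-bounded : ∀ s k → Bounded (Cut k) (mass s) 1#
    Cut-bounded s zero = bounded (hasSum-≈ (sum-δ s) (hasSum-singleton {x = ⟪ [] , empty ⟫}
      (inj₁ (≡.refl , empty)) uniq (sum-nonNeg (δ-nonNeg s))))
      where
      uniq : ∀ {y} → Cut zero y → y ≡ ⟪ [] , empty ⟫
      uniq {⟪ [] , _ ⟫} _ = ≡.refl
      uniq {⟪ _ ∷ _ , _ ⟫} (inj₁ (() , _))
    Cut-bounded s (suc k) = bounded-total (Cut-fibration k) fibre (Cut-bounded s k)
      where
      fibre : ∀ {y} → Cut k y → Bounded (λ x → Stays k y x ⊎ Grows k y x) (mass s) (mass s y)
      fibre {y} c with em {P = IsMaximal 𝓔 (events y)}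
      ... | yes max = λ l u a → bounded (hasSum-singleton ≡.refl (λ eq → eq) (sum-nonNeg (0≤φ s (Cut-trace {k} {y} c))))
                        l u (All.map (λ { (inj₁ (eq , _)) → eq
                                        ; (inj₂ ((_ , _ , t) , _)) → contradiction max (extends⇒¬maximal t) }) a)
      ... | no ¬max = λ l u a → children-bounded s y (Cut-trace {k} {y} c) l u
                        (All.map (λ { (inj₁ (≡.refl , max , _)) → contradiction max ¬max
                                    ; (inj₂ (child , _)) → child }) a)

    Max : Trace 𝓔 → Set₁
    Max α = IsMaximal 𝓔 (events α)

    private
      longest : ∀ (l : List (Trace 𝓔)) → ∃[ k ] All (λ x → length (events x) ℕ.≤ k) l
      longest []      = 0 , []
      longest (x ∷ l) with k , le ← longest l = length (events x) ℕ.⊔ k ,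
        ℕ.m≤m⊔n _ k ∷ All.map (λ p → ℕ.≤-trans p (ℕ.m≤n⊔m (length (events x)) k)) le

    -- Finitely many maximal traces have a longest one, so they all lie in a single cut.
    maximal-bounded : ∀ s → Bounded Max (mass s) 1#
    maximal-bounded s l u a with k , le ← longest l = Cut-bounded s (suc k) l u
      (All.tabulate λ x∈l → inj₂ (ℕ.s≤s (All.lookup le x∈l) , All.lookup a x∈l))

    -- Available for every scheduler, since the partial sums are bounded by 1. So the outcomes of
    -- the constructed scheduler can be named before their mass is known to be 1.
    outcome : ∀ s → ∃ (Outcome 𝓔 σ s)
    outcome s = (λ u → proj₁ (at u)) , λ u → proj₂ (at u)
      where
      at : ∀ u → ∃ (HasSum Max λ α → φ 𝓔 σ s α u)
      at u = hasSum-exists λ l u! a → ≤-trans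
        (Σₗ-mono l λ x∈l → ≤-sum (0≤φ s (proj₁ (All.lookup a x∈l))) u) (maximal-bounded s l u! a)

    module _ {s} {μ : Point} (out : Outcome 𝓔 σ s μ) where

      outcome-nonNeg : ∀ u → 0# ≤ μ u
      outcome-nonNeg u = bounded (out u) [] [] []

      outcome-mass : sum μ ≤ 1#
      outcome-mass = least (hasSum-sum (λ max → 0≤φ s (proj₁ max)) out) (maximal-bounded s)

  sched₁-dist : ∀ {𝓔 : IPBES} {σ : PreScheduler 𝓔} → Sched₁ 𝓔 σ → ∀ {s μ} → Outcome 𝓔 σ s μ → IsDist μ
  sched₁-dist (_ , total) {s} out with ν , ν-out , 0≤ν , ν-sum ← total s =
    (λ u → ≤-respʳ-≈ (hasSum-unique (ν-out u) (out u)) (0≤ν u)) ,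
    trans (sum-cong-≋ λ u → hasSum-unique (out u) (ν-out u)) ν-sum

  sum-≤⇒≈ : ∀ {k} {x y : Vector Carrier k} → (∀ i → x i ≤ y i) → sum y ≤ sum x → ∀ i → x i ≈ y i
  sum-≤⇒≈ {suc k} {x} {y} x≤y le zero = antisym (x≤y zero)
    (+-cancelʳ-≤ (sum (y ∘ suc)) (≤-trans le (+-mono-≤ ≤-refl (sum-mono-≤ (x≤y ∘ suc)))))
  sum-≤⇒≈ {suc k} {x} {y} x≤y le (suc i) = sum-≤⇒≈ (x≤y ∘ suc)
    (+-cancelˡ-≤ (y zero) (≤-trans le (+-mono-≤ (x≤y zero) ≤-refl))) i

  *-cancelˡ-≈ : ∀ {c x y} → ¬ (c ≈ 0#) → c * x ≈ c * y → x ≈ y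
  *-cancelˡ-≈ {c} {x} {y} c≉0 eq with d , cd≈1 ← inverse c c≉0 =
    trans (sym (undo x)) (trans (*-congˡ eq) (undo y))
    where
    undo : ∀ z → d * (c * z) ≈ z
    undo z = trans (sym (*-assoc d c z)) (trans (*-congʳ (trans (*-comm d c) cd≈1)) (*-identityˡ z))

  module _ {𝓔 : IPBES} {σ : PreScheduler 𝓔} (isSched : IsScheduler 𝓔 σ) where
    open SchedulerProperties isSched

    -- No outcome has mass above 1, so the p-weighted total can only be sum p if each of them has mass exactly 1.
    mixed-outcome : ∀ {p V : Point} → (∀ s → 0# ≤ p s) → (∀ s → ¬ (p s ≈ 0#)) → sum V ≈ sum p →
      (∀ u → HasSum Max (λ α → sum λ s → p s * φ 𝓔 σ s α u) (V u)) →
      Sched₁ 𝓔 σ × (∀ u → sum (λ s → p s * proj₁ (outcome s) u) ≈ V u)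
    mixed-outcome {p} {V} 0≤p p≉0 mass≈ hs = (isSched , λ s → μ s , out s , outcome-nonNeg (out s) , full s) , mix
      where
      μ : Ω → Point
      μ s = proj₁ (outcome s)
      out : ∀ s → Outcome 𝓔 σ s (μ s)
      out s = proj₂ (outcome s)
      mix : ∀ u → sum (λ s → p s * μ s u) ≈ V u
      mix u = hasSum-unique (hasSum-sum (λ max s → *-nonNeg (0≤p s) (0≤φ s (proj₁ max) u)) (λ s → hasSum-* (0≤p s) (out s u))) (hs u)
      total-mass : sum (λ s → p s * sum (μ s)) ≈ sum p
      total-mass = begin-equality
        sum (λ s → p s * sum (μ s))            ≈⟨ sum-cong-≋ (λ s → *-distribˡ-sum (p s) (μ s)) ⟩
        sum (λ s → sum λ u → p s * μ s u)      ≈⟨ ∑-comm (λ s u → p s * μ s u) ⟩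
        sum (λ u → sum λ s → p s * μ s u)      ≈⟨ sum-cong-≋ mix ⟩
        sum V                                  ≈⟨ mass≈ ⟩
        sum p                                  ∎
        where open ≤-Reasoning
      full : ∀ s → sum (μ s) ≈ 1#
      full s = *-cancelˡ-≈ (p≉0 s) (trans
        (sum-≤⇒≈ (λ s → ≤-respʳ-≈ (*-identityʳ _) (*-monoˡ-≤ (0≤p s) (outcome-mass (out s)))) (≤-reflexive (sym total-mass)) s)
        (sym (*-identityʳ _)))

-- From a flow on a tree of runs to a scheduler on 𝓕.

module Transfer (em : ∀ {ℓ} → ExcludedMiddle ℓ) (ℝ : CompleteOrderedField) (n : ℕ) where

  open Programs ℝ n
  open CompleteOrderedField ℝ hiding (zero)
  open Summation em ℝ
  open Schedules em ℝ n
  open Trace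

  module _ (X : ℍ̄₁) (t : Ω) where
    private
      C : Pred Point 0ℓ
      C = ⟨ X ⟩ t

    member-resp : ∀ {μ ν} → μ ≋ ν → C μ → C ν
    member-resp eq = 𝒫𝔻.resp (ℍ̄₁.at X t) eq

    -- For a test all members coincide with the point distribution at `t`, and so does any convex
    -- combination of them.
    member-convex : Convex C
    member-convex {μ} {ν} μ∈ ν∈ p 0≤p p≤1 with ℍ̄₁.kind X
    ... | inj₁ program = proj₁ (proj₂ (program t)) μ∈ ν∈ p 0≤p p≤1
    ... | inj₂ test    = member-resp (λ u → begin-equality
      μ u                              ≈⟨ test t μ∈ u ⟩
      δ[ t ] u                         ≈⟨ *-identityˡ _ ⟨
      1# * δ[ t ] u                    ≈⟨ *-congʳ (x-y+y≈x 1# p) ⟨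
      ((1# - p) + p) * δ[ t ] u        ≈⟨ *-congʳ (+-comm _ _) ⟩
      (p + (1# - p)) * δ[ t ] u        ≈⟨ distribʳ _ _ _ ⟩
      p * δ[ t ] u + (1# - p) * δ[ t ] u ≈⟨ +-cong (*-congˡ (test t μ∈ u)) (*-congˡ (test t ν∈ u)) ⟨
      p * μ u + (1# - p) * ν u         ∎) μ∈
      where open ≤-Reasoning

    -- Convexity for unnormalised weights. Only points carrying mass have to lie in `C`, and an
    -- average exists only for non-zero total mass, hence the alternatives on both sides. Points are
    -- added one at a time.
    member-cone : ∀ {a} {A : Set a} {m : A → Carrier} {κ : A → Point} l →
      (∀ {y} → y ∈ l → 0# ≤ m y) → (∀ {y} → y ∈ l → m y ≈ 0# ⊎ C (κ y)) →
      Σₗ m l ≈ 0# ⊎ ∃[ μ ] C μ × ∀ u → Σₗ (λ y → m y * κ y u) l ≈ Σₗ m l * μ u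
    member-cone [] _ _ = inj₁ refl
    member-cone {m = m} {κ} (y ∷ l) 0≤m κ∈ with em {P = m y ≈ 0#} | member-cone l (0≤m ∘ there) (κ∈ ∘ there)
    ... | yes m≈0 | inj₁ S≈0 = inj₁ (trans (+-cong m≈0 S≈0) (+-identityˡ 0#))
    ... | yes m≈0 | inj₂ (μ , μ∈ , eq) = inj₂ (μ , μ∈ , λ u →
      trans (+-cong (trans (*-congʳ m≈0) (trans (zeroˡ _) (sym (trans (*-congʳ m≈0) (zeroˡ _))))) (eq u))
            (sym (distribʳ (μ u) _ _)))
    ... | no m≉0 | ih with κ∈ (here ≡.refl)
    ...   | inj₁ m≈0 = contradiction m≈0 m≉0
    ...   | inj₂ κy∈ with ih
    ...     | inj₁ S≈0 = inj₂ (κ y , κy∈ , λ u →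
      trans (+-congˡ (trans (Σₗ-zero l λ z∈l → trans (*-congʳ (zeros z∈l)) (zeroˡ _)) (sym (trans (*-congʳ S≈0) (zeroˡ _)))))
            (sym (distribʳ (κ y u) _ _)))
      where
      zeros : ∀ {z} → z ∈ l → m z ≈ 0#
      zeros z∈l = antisym (≤-respʳ-≈ S≈0 (≤-Σₗ z∈l (0≤m ∘ there))) (0≤m (there z∈l))
    ...     | inj₂ (μ , μ∈ , eq) = inj₂ (ν , member-convex κy∈ μ∈ r 0≤r r≤1 , λ u → trans (+-congˡ (eq u)) (sym (ν-eq u)))
      where
      S = Σₗ m l
      M = m y + S
      0≤S = Σₗ-nonNeg l (0≤m ∘ there)
      my≤M : m y ≤ M
      my≤M = x≤x+y 0≤S
      M≉0 : ¬ (M ≈ 0#)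
      M≉0 M≈0 = m≉0 (antisym (≤-respʳ-≈ M≈0 my≤M) (0≤m (here ≡.refl)))
      inv = inverse⁺ (≤-trans (0≤m (here ≡.refl)) my≤M) M≉0
      q = proj₁ inv
      0≤q = proj₁ (proj₂ inv)
      Mq≈1 : M * q ≈ 1#
      Mq≈1 = proj₂ (proj₂ inv)
      -- The share of `y` in the total mass `M`; then `M * r` is `m y` and `M` times the
      -- complementary share is `S`.
      r = q * m y
      0≤r : 0# ≤ r
      0≤r = *-nonNeg 0≤q (0≤m (here ≡.refl))
      r≤1 : r ≤ 1#
      r≤1 = ≤-respʳ-≈ (trans (*-comm q M) Mq≈1) (*-monoˡ-≤ 0≤q my≤M)
      ν : Point
      ν = r · κ y ⊕ (1# - r) · μ
      Mr : M * r ≈ m y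
      Mr = trans (sym (*-assoc M q (m y))) (trans (*-congʳ Mq≈1) (*-identityˡ (m y)))
      M1-r : M * (1# - r) ≈ S
      M1-r = +-cancelʳ-≈ (m y) (begin-equality
        M * (1# - r) + m y      ≈⟨ +-congˡ Mr ⟨
        M * (1# - r) + M * r    ≈⟨ distribˡ M (1# - r) r ⟨
        M * ((1# - r) + r)      ≈⟨ *-congˡ (x-y+y≈x 1# r) ⟩
        M * 1#                  ≈⟨ *-identityʳ M ⟩
        m y + S                 ≈⟨ +-comm (m y) S ⟩
        S + m y                 ∎)
        where open ≤-Reasoning
      ν-eq : ∀ u → M * ν u ≈ m y * κ y u + S * μ u
      ν-eq u = trans (distribˡ M _ _) (+-cong (trans (sym (*-assoc M r (κ y u))) (*-congʳ Mr))
                                              (trans (sym (*-assoc M (1# - r) (μ u))) (*-congʳ M1-r)))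

  -- A tree of runs mapped to the traces of 𝓕 by f.  Φ y is the measure on states after the run y, m y the measure of the
  -- states in which its last step is taken, κ y the kernel of that step, and p the measure at the root.
  record Source (𝓕 : IPBES) (p : Point) : Set₂ where
    open IPBES 𝓕 using (Event; lab)
    field
      Node   : Set₁
      root   : Node
      parent : Node → Maybe Node
      f      : Node → List Event
      Φ m    : Node → Point
      κ      : Node → Ω → Point

    Final : Node → Set₁
    Final x = ∀ y → parent y ≢ just x

    IsStart : Node → Set₁
    IsStart y = y ≡ root × f y ≡ [] × Φ y ≋ p

    IsStutter : Node → Set₁
    IsStutter y = ∃[ x ] parent y ≡ just x × f y ≡ f x × Φ y ≋ m y

    IsStep : Node → Set₁
    IsStep y = ∃[ x ] parent y ≡ just x × ∃[ e ] f y ≡ e ∷ f x ×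
      (∀ t → m y t ≈ 0# ⊎ ⟨ lab e ⟩ t (κ y t)) × Φ y ≋ λ u → sum λ t → m y t * κ y t u

    field
      0≤Φ         : ∀ x u → 0# ≤ Φ x u
      0≤m         : ∀ x u → 0# ≤ m x u
      f-trace     : ∀ x → IsTrace 𝓕 (f x)
      f-finite    : ∀ β → ∃[ l ] ∀ x → f x ≡ β → x ∈ l
      parent-root : parent root ≡ nothing
      kind        : ∀ y → IsStart y ⊎ IsStutter y ⊎ IsStep y
      flow        : ∀ x → ¬ Final x → ∀ t → HasSum (λ y → parent y ≡ just x) (λ y → m y t) (Φ x t)
      final-max   : ∀ {x} → Final x → IsMaximal 𝓕 (f x)

  x∷xs≢xs : ∀ {a} {A : Set a} {x : A} {xs} → xs ≢ x ∷ xs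
  x∷xs≢xs eq = ℕ.1+n≢n (≡.sym (≡.cong length eq))

  module Simulated {𝓕 : IPBES} (feasible : Feasible 𝓕) {p : Point} (source : Source 𝓕 p) where
    open IPBES 𝓕 using (Event; lab)
    open Source source

    _≟ₙ_ : (x y : Node) → Dec (x ≡ y)
    x ≟ₙ y = em

    fibre : List Event → List Node
    fibre β = filter (λ x → em {P = f x ≡ β}) (deduplicate _≟ₙ_ (proj₁ (f-finite β)))

    fibre-unique : ∀ β → Unique (fibre β)
    fibre-unique β = Unique.filter⁺ _ (deduplicate-! _≟ₙ_ (proj₁ (f-finite β)))

    ∈-fibre⁺ : ∀ {x β} → f x ≡ β → x ∈ fibre β
    ∈-fibre⁺ {x} {β} eq = ∈-filter⁺ _ (∈-deduplicate⁺ _≟ₙ_ (proj₂ (f-finite β) x eq)) eq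

    ∈-fibre⁻ : ∀ {x β} → x ∈ fibre β → f x ≡ β
    ∈-fibre⁻ {x} {β} x∈ = proj₂ (∈-filter⁻ (λ x → em {P = f x ≡ β}) {xs = deduplicate _≟ₙ_ (proj₁ (f-finite β))} x∈)

    fibre-where : (Node → Set₁) → List Event → List Node
    fibre-where P β = filter (λ x → em {P = P x}) (fibre β)

    fibre-where-unique : ∀ P β → Unique (fibre-where P β)
    fibre-where-unique P β = Unique.filter⁺ _ (fibre-unique β)

    ∈-fibre-where⁺ : ∀ P {x β} → f x ≡ β → P x → x ∈ fibre-where P β
    ∈-fibre-where⁺ P eq px = ∈-filter⁺ _ (∈-fibre⁺ eq) px

    ∈-fibre-where⁻ : ∀ P {x β} → x ∈ fibre-where P β → f x ≡ β × P x
    ∈-fibre-where⁻ P {β = β} x∈ with x∈f , px ← ∈-filter⁻ (λ x → em {P = P x}) {xs = fibre β} x∈ = ∈-fibre⁻ x∈f , px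

    -- Along a chain of stutters the same mass is carried by several nodes of one fibre. Counting it
    -- only at the entries makes `inflow` the measure with which the fibre is reached.
    Inner Entry : Node → Set₁
    Inner y = ∃[ x ] parent y ≡ just x × f x ≡ f y
    Entry y = ¬ Inner y

    entries : List Event → List Node
    entries = fibre-where Entry

    inflow stopped : List Event → Point
    inflow β u = Σₗ (λ y → Φ y u) (entries β)
    stopped β u = Σₗ (λ y → Φ y u) (fibre-where Final β)

    -- Read off at the entries of the next fibre, but through `m`, so it measures the state before
    -- the step with event `e`.
    outflow : List Event → Event → Point
    outflow β e t = Σₗ (λ y → m y t) (entries (e ∷ β))

    outkernel : List Event → Event → Ω → Point
    outkernel β e t u = Σₗ (λ y → m y t * κ y t u) (entries (e ∷ β))

    -- A start has empty image and a stutter is inner, so an entry over a non-empty trace must be a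
    -- step.
    entry-kind : ∀ {y β e} → y ∈ entries (e ∷ β) →
      (∃[ x ] parent y ≡ just x × f x ≡ β) × f y ≡ e ∷ β ×
      (∀ t → m y t ≈ 0# ⊎ ⟨ lab e ⟩ t (κ y t)) × Φ y ≋ λ u → sum λ t → m y t * κ y t u
    entry-kind {y} y∈ with ∈-fibre-where⁻ Entry y∈ | kind y
    ... | eq , entry | inj₁ (_ , f≡[] , _) with () ← ≡.trans (≡.sym f≡[]) eq
    ... | eq , entry | inj₂ (inj₁ (x , par , f≡ , _)) = contradiction (x , par , ≡.sym f≡) entry
    ... | eq , entry | inj₂ (inj₂ (x , par , e , f≡ , mem , Φ≋)) with ≡.refl ← ≡.trans (≡.sym f≡) eq =
      (x , par , ≡.refl) , eq , mem , Φ≋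

    inner-kind : ∀ {y} → Inner y → Φ y ≋ m y
    inner-kind {y} (x , par , eq) with kind y
    ... | inj₁ (≡.refl , _) with () ← ≡.trans (≡.sym parent-root) par
    ... | inj₂ (inj₁ (_ , _ , _ , Φ≋)) = Φ≋
    ... | inj₂ (inj₂ (x′ , par′ , e , f≡ , _)) with ≡.refl ← just-injective (≡.trans (≡.sym par) par′) =
      contradiction (≡.trans eq f≡) x∷xs≢xs

    module _ (β : List Event) (t : Ω) where

      private
        Child : Node → Set₁
        Child y = ∃[ x ] parent y ≡ just x × f x ≡ β

        moving : List Node
        moving = fibre-where (λ x → ¬ Final x) β

        inner : List Node
        inner = fibre-where Inner β

        mₜ Φₜ : Node → Carrier
        mₜ y = m y t
        Φₜ y = Φ y t

        from-moving : HasSum Child mₜ (Σₗ Φₜ moving)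
        from-moving = hasSum-total fibration
          (λ {x} x∈ → flow x (proj₂ (∈-fibre-where⁻ (λ x → ¬ Final x) x∈)) t)
          (hasSum-finite (fibre-where-unique _ β) (λ x∈ → x∈) (λ x∈ → x∈) (λ _ → 0≤Φ _ t))
          where
          fibration : Fibration Child (_∈ moving) (λ x y → parent y ≡ just x)
          fibration = record
            { cover    = λ (x , par , eq) → x , ∈-fibre-where⁺ (λ x → ¬ Final x) eq (λ final → final _ par) , par
            ; total⁻   = λ x∈ par → _ , par , proj₁ (∈-fibre-where⁻ (λ x → ¬ Final x) x∈)
            ; disjoint = λ par par′ → just-injective (≡.trans (≡.sym par) par′)
            }

        -- The places to which a child of the fibre can go: `nothing` stands for stuttering inside
        -- the fibre of `β`, `just e` for entering that of `e ∷ β`.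
        Target : Maybe Event → Set₁
        Target nothing  = ⊤
        Target (just e) = IsTrace 𝓕 (e ∷ β)

        Into : Maybe Event → Node → Set₁
        Into nothing  y = Child y × f y ≡ β
        Into (just e) y = Child y × f y ≡ e ∷ β

        amount : Maybe Event → Carrier
        amount nothing  = Σₗ mₜ inner
        amount (just e) = outflow β e t

        into-fibration : Fibration Child Target Into
        into-fibration = record
          { cover    = cover
          ; total⁻   = λ { {y = nothing} _ (c , _) → c ; {y = just _} _ (c , _) → c }
          ; disjoint = disjoint
          }
          where
          cover : ∀ {y} → Child y → ∃[ e ] Target e × Into e y
          cover {y} c@(x , par , ≡.refl) with kind y
          ... | inj₁ (≡.refl , _) with () ← ≡.trans (≡.sym parent-root) par
          ... | inj₂ (inj₁ (x′ , par′ , f≡ , _)) with ≡.refl ← just-injective (≡.trans (≡.sym par) par′) =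
            nothing , _ , c , f≡
          ... | inj₂ (inj₂ (x′ , par′ , e , f≡ , _)) with ≡.refl ← just-injective (≡.trans (≡.sym par) par′) =
            just e , ≡.subst (IsTrace 𝓕) f≡ (f-trace y) , c , f≡
          disjoint : ∀ {y e e′} → Into e y → Into e′ y → e ≡ e′
          disjoint {e = nothing} {nothing} _ _ = ≡.refl
          disjoint {e = nothing} {just _}  (_ , eq) (_ , eq′) = contradiction (≡.trans (≡.sym eq) eq′) x∷xs≢xs
          disjoint {e = just _}  {nothing} (_ , eq) (_ , eq′) = contradiction (≡.trans (≡.sym eq′) eq) x∷xs≢xs
          disjoint {e = just _}  {just _}  (_ , eq) (_ , eq′) = ≡.cong just (∷-injectiveˡ (≡.trans (≡.sym eq) eq′))

        into-sum : ∀ {e} → Target e → HasSum (Into e) mₜ (amount e)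
        into-sum {nothing} _ = hasSum-finite (fibre-where-unique Inner β)
          (λ ((x , par , eq) , eq′) → ∈-fibre-where⁺ Inner eq′ (x , par , ≡.trans eq (≡.sym eq′)))
          (λ y∈ → let eq , (x , par , eq′) = ∈-fibre-where⁻ Inner y∈ in (x , par , ≡.trans eq′ eq) , eq)
          (λ _ → 0≤m _ t)
        into-sum {just e} _ = hasSum-finite (fibre-where-unique Entry (e ∷ β))
          (λ ((x , par , eq) , eq′) → ∈-fibre-where⁺ Entry eq′ λ (x′ , par′ , eq″) → x∷xs≢xs (begin
            β      ≡⟨ eq ⟨
            f x    ≡⟨ ≡.cong f (just-injective (≡.trans (≡.sym par) par′)) ⟩
            f x′   ≡⟨ eq″ ⟩
            f _    ≡⟨ eq′ ⟩
            e ∷ β  ∎))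
          (λ y∈ → let c , eq , _ = entry-kind y∈ in c , eq)
          (λ _ → 0≤m _ t)
          where open ≡.≡-Reasoning

      -- The children of the non-final nodes of the fibre receive exactly the mass of these nodes.
      -- What remains after the inner children are removed is the outflow.
      conservation : HasSum (λ e → IsTrace 𝓕 (e ∷ β)) (λ e → outflow β e t) (inflow β t - stopped β t)
      conservation = hasSum-≈ balance
        (hasSum-just (Σₗ-nonNeg inner λ _ → 0≤m _ t) (λ _ → Σₗ-nonNeg (entries _) λ _ → 0≤m _ t) _
          (hasSum-base into-fibration into-sum from-moving))
        where
        -- After adding `i + s`, both sides are the total mass of the fibre, split once by `Final`
        -- and once by `Inner`; on inner nodes `Φ` and `m` agree because stutters keep the state.
        balance : Σₗ Φₜ moving - Σₗ mₜ inner ≈ inflow β t - stopped β t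
        balance = +-cancelʳ-≈ (i + s) (begin-equality
          (Σₗ Φₜ moving - i) + (i + s)  ≈⟨ +-assoc _ _ _ ⟨
          ((Σₗ Φₜ moving - i) + i) + s  ≈⟨ +-congʳ (x-y+y≈x _ _) ⟩
          Σₗ Φₜ moving + s              ≈⟨ +-comm _ _ ⟩
          s + Σₗ Φₜ moving              ≈⟨ Σₗ-filter Φₜ Final (fibre β) ⟨
          Σₗ Φₜ (fibre β)               ≈⟨ Σₗ-filter Φₜ Inner (fibre β) ⟩
          Σₗ Φₜ inner + inflow β t      ≈⟨ +-congʳ (Σₗ-cong inner λ y∈ → inner-kind (proj₂ (∈-fibre-where⁻ Inner y∈)) t) ⟩
          i + inflow β t                ≈⟨ +-comm _ _ ⟩
          inflow β t + i                ≈⟨ +-congʳ (x-y+y≈x _ _) ⟨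
          ((inflow β t - s) + s) + i    ≈⟨ +-assoc _ _ _ ⟩
          (inflow β t - s) + (s + i)    ≈⟨ +-congˡ (+-comm s i) ⟩
          (inflow β t - s) + (i + s)    ∎)
          where
          open ≤-Reasoning
          i = Σₗ mₜ inner
          s = stopped β t

      0≤inflow : 0# ≤ inflow β t
      0≤inflow = Σₗ-nonNeg (entries β) λ _ → 0≤Φ _ t

      0≤outflow : ∀ e → 0# ≤ outflow β e t
      0≤outflow e = Σₗ-nonNeg (entries (e ∷ β)) λ _ → 0≤m _ t

      -- No event extends a maximal `β`, so the sum in `conservation` is empty and its value is
      -- zero.
      stopped-all : IsMaximal 𝓕 β → stopped β t ≈ inflow β t
      stopped-all max = sym (+-cancelʳ-≈ (- stopped β t) (trans
        (hasSum-empty (λ e t → extends⇒¬maximal t max) conservation) (sym (-‿inverseʳ _))))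

      module _ (¬max : ¬ IsMaximal 𝓕 β) where

        -- Final nodes lie over maximal traces only, so nothing stops in this fibre.
        outflow-sum : HasSum (λ e → IsTrace 𝓕 (e ∷ β)) (λ e → outflow β e t) (inflow β t)
        outflow-sum = hasSum-≈ (trans (+-congˡ (trans (-‿cong none) -0#≈0#)) (+-identityʳ _)) conservation
          where
          open import Algebra.Properties.Ring ring using (-0#≈0#)
          none : stopped β t ≈ 0#
          none = Σₗ-zero (fibre-where Final β) λ y∈ → let eq , final = ∈-fibre-where⁻ Final y∈ in
            contradiction (≡.subst (IsMaximal 𝓕) eq (final-max final)) ¬max

        outflow≤inflow : ∀ e → outflow β e t ≤ inflow β t
        outflow≤inflow e with em {P = IsTrace 𝓕 (e ∷ β)}
        ... | yes tr = ≤-respˡ-≈ (+-identityʳ _) (bounded outflow-sum (e ∷ []) ([] ∷ []) (tr ∷ []))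
        ... | no ¬tr = ≤-respˡ-≈ (sym (Σₗ-zero (entries (e ∷ β)) λ y∈ →
          contradiction (≡.subst (IsTrace 𝓕) (proj₁ (proj₂ (entry-kind y∈))) (f-trace _)) ¬tr)) 0≤inflow

    outflow-zero : ∀ {β e t} → outflow β e t ≈ 0# → ∀ u → outkernel β e t u ≈ 0#
    outflow-zero {β} {e} {t} eq u = Σₗ-zero (entries (e ∷ β)) λ y∈ → trans
      (*-congʳ (antisym (≤-respʳ-≈ eq (≤-Σₗ y∈ λ _ → 0≤m _ t)) (0≤m _ t))) (zeroˡ _)

    -- What a scheduler needs at `β` in the single state `t`. The `link` expresses the conditional
    -- law multiplied out, so that it also makes sense where the inflow is zero.
    record Row (β : List Event) (t : Ω) : Set₁ where
      field
        w      : Event → Carrier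
        k      : Event → Point
        0≤w    : ∀ e → 0# ≤ w e
        w≤1    : ∀ e → w e ≤ 1#
        w-sum  : HasSum (λ e → IsTrace 𝓕 (e ∷ β)) w 1#
        kernel : ∀ e → (∃[ μ ] ⟨ lab e ⟩ t μ × k e ≋ w e · μ) ⊎ (w e ≈ 0# × k e ≋ 𝟎)
        link   : ∀ e u → k e u * inflow β t ≈ outkernel β e t u

    -- Where β is reached in state t, τ follows the conditional flow; elsewhere it only has to avoid a deadlock.
    row : ∀ β → IsTrace 𝓕 β → ¬ IsMaximal 𝓕 β → ∀ t → Row β t
    row β tr ¬max t with em {P = inflow β t ≈ 0#}
    ... | yes I≈0 = let e₀ , tr₀ , μ₀ , μ₀∈ = feasible β tr ¬max t in fallback e₀ tr₀ μ₀ μ₀∈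
      where
      fallback : ∀ e₀ → IsTrace 𝓕 (e₀ ∷ β) → ∀ μ₀ → ⟨ lab e₀ ⟩ t μ₀ → Row β t
      fallback e₀ tr₀ μ₀ μ₀∈ = record
        { w = w ; k = λ e → w e · μ₀ ; 0≤w = 0≤w ; w≤1 = w≤1 ; kernel = kernel
        ; w-sum = hasSum-support {S = _≡ e₀} w≈0 (hasSum-≈ w₀ (hasSum-singleton (tr₀ , ≡.refl) proj₂ (0≤w e₀)))
        -- Zero inflow forces zero outflow, so both sides vanish whichever event was chosen.
        ; link  = λ e u → trans (trans (*-congˡ I≈0) (zeroʳ _)) (sym (outflow-zero
            (antisym (≤-respʳ-≈ I≈0 (outflow≤inflow β t ¬max e)) (0≤outflow β t e)) u))
        }
        where
        w : Event → Carrier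
        w e = if does (em {P = e ≡ e₀}) then 1# else 0#
        0≤w : ∀ e → 0# ≤ w e
        0≤w e with em {P = e ≡ e₀}
        ... | yes _ = 0≤1
        ... | no  _ = ≤-refl
        w≤1 : ∀ e → w e ≤ 1#
        w≤1 e with em {P = e ≡ e₀}
        ... | yes _ = ≤-refl
        ... | no  _ = 0≤1
        w≈0 : ∀ {e} → IsTrace 𝓕 (e ∷ β) → e ≢ e₀ → w e ≈ 0#
        w≈0 {e} _ e≢ with em {P = e ≡ e₀}
        ... | yes e≡ = contradiction e≡ e≢
        ... | no  _  = refl
        w₀ : w e₀ ≈ 1#
        w₀ with em {P = e₀ ≡ e₀}
        ... | yes _ = refl
        ... | no ≢  = contradiction ≡.refl ≢
        kernel : ∀ e → (∃[ μ ] ⟨ lab e ⟩ t μ × w e · μ₀ ≋ w e · μ) ⊎ (w e ≈ 0# × w e · μ₀ ≋ 𝟎)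
        kernel e with em {P = e ≡ e₀}
        ... | yes ≡.refl = inj₁ (μ₀ , μ₀∈ , λ _ → refl)
        ... | no  _      = inj₂ (refl , λ _ → zeroˡ _)
    ... | no I≉0 = conditional (inverse⁺ (0≤inflow β t) I≉0)
      where
      I = inflow β t
      conditional : ∃[ c ] 0# ≤ c × I * c ≈ 1# → Row β t
      conditional (c , 0≤c , Ic≈1) = record
        { w = λ e → c * outflow β e t ; k = λ e u → c * outkernel β e t u
        ; 0≤w    = λ e → *-nonNeg 0≤c (0≤outflow β t e)
        ; w≤1    = λ e → ≤-respʳ-≈ cI≈1 (*-monoˡ-≤ 0≤c (outflow≤inflow β t ¬max e))
        ; w-sum  = hasSum-≈ cI≈1 (hasSum-* 0≤c (outflow-sum β t ¬max))
        ; kernel = kernel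
        ; link   = λ e u → begin-equality
            c * outkernel β e t u * I    ≈⟨ *-comm _ _ ⟩
            I * (c * outkernel β e t u)  ≈⟨ *-assoc _ _ _ ⟨
            I * c * outkernel β e t u    ≈⟨ *-congʳ Ic≈1 ⟩
            1# * outkernel β e t u       ≈⟨ *-identityˡ _ ⟩
            outkernel β e t u            ∎
        }
        where
        open ≤-Reasoning
        cI≈1 : c * I ≈ 1#
        cI≈1 = trans (*-comm c I) Ic≈1
        kernel : ∀ e → (∃[ μ ] ⟨ lab e ⟩ t μ × (λ u → c * outkernel β e t u) ≋ (c * outflow β e t) · μ) ⊎
                       (c * outflow β e t ≈ 0# × (λ u → c * outkernel β e t u) ≋ 𝟎)
        kernel e with member-cone (lab e) t {m = λ y → m y t} {κ = λ y → κ y t} (entries (e ∷ β))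
                        (λ _ → 0≤m _ t) (λ y∈ → proj₁ (proj₂ (proj₂ (entry-kind y∈))) t)
        ... | inj₁ O≈0 = inj₂ (trans (*-congˡ O≈0) (zeroʳ c) , λ u → trans (*-congˡ (outflow-zero O≈0 u)) (zeroʳ c))
        ... | inj₂ (μ , μ∈ , eq) = inj₁ (μ , μ∈ , λ u → trans (*-congˡ (eq u)) (sym (*-assoc c _ _)))

    private
      -- The validity proof inside a `Trace` is irrelevant, so it is decided afresh. Every trace
      -- with an extension is live, hence the zero defaults below never occur on the domain of the
      -- scheduler.
      Live : List Event → Set₁
      Live β = IsTrace 𝓕 β × ¬ IsMaximal 𝓕 β

      live : ∀ {β e} → IsTrace 𝓕 (e ∷ β) → Live β
      live t = prefix t , extends⇒¬maximal t

      rowₗ : ∀ {β} → Live β → ∀ t → Row β t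
      rowₗ (tr , ¬max) = row _ tr ¬max

      weight : ∀ {β} → Dec (Live β) → Event → Ω → Carrier
      weight (yes l) e t = Row.w (rowₗ l t) e
      weight (no _)  e t = 0#

      branch : ∀ {β} → Dec (Live β) → Event → Ω → Point
      branch (yes l) e t = Row.k (rowₗ l t) e
      branch (no _)  e t = 𝟎

    τ : PreScheduler 𝓕
    τ β e _ = branch (em {P = Live (events β)}) e

    τ-isScheduler : IsScheduler 𝓕 τ
    τ-isScheduler β = subdist , weight dec , in[0,1] , conditions , total₁
      where
      dec = em {P = Live (events β)}
      in[0,1] : ∀ e s → 0# ≤ weight dec e s × weight dec e s ≤ 1#
      in[0,1] e s with em {P = Live (events β)}
      ... | yes l = Row.0≤w (rowₗ l s) e , Row.w≤1 (rowₗ l s) e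
      ... | no _  = ≤-refl , 0≤1
      kernel : ∀ e → IsTrace 𝓕 (e ∷ events β) → ∀ s →
        (∃[ μ ] ⟨ lab e ⟩ s μ × branch dec e s ≋ weight dec e s · μ) ⊎ (weight dec e s ≈ 0# × branch dec e s ≋ 𝟎)
      kernel e t s with em {P = Live (events β)}
      ... | yes l = Row.kernel (rowₗ l s) e
      ... | no ¬l = contradiction (live t) ¬l
      conditions : ∀ e (t : IsTrace 𝓕 (e ∷ events β)) s →
        (Satisfiable (⟨ lab e ⟩ s) → ∃[ μ ] ⟨ lab e ⟩ s μ × branch dec e s ≋ weight dec e s · μ) ×
        (Empty (⟨ lab e ⟩ s) → weight dec e s ≈ 0# × branch dec e s ≋ 𝟎)
      conditions e t s with kernel e t s
      ... | inj₁ (μ , μ∈ , eq) = (λ _ → μ , μ∈ , eq) , λ ∅ → contradiction μ∈ (∅ μ)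
      -- With weight zero any member of the label serves as the required distribution.
      ... | inj₂ (w≈0 , eq) = (λ (μ , μ∈) → μ , μ∈ , λ u → trans (eq u) (sym (trans (*-congʳ w≈0) (zeroˡ _)))) , λ _ → w≈0 , eq
      subdist : ∀ e (t : IsTrace 𝓕 (e ∷ events β)) s → IsSubDist (branch dec e s)
      subdist e t s with kernel e t s
      ... | inj₁ (μ , μ∈ , eq) = let 0≤μ , μ-sum = 𝒫𝔻.dist (ℍ̄₁.at (lab e) s) μ∈ ; 0≤w , w≤1 = in[0,1] e s in
        (λ u → ≤-respʳ-≈ (sym (eq u)) (*-nonNeg 0≤w (0≤μ u))) ,
        ≤-respˡ-≈ (sym (trans (sum-cong-≋ eq) (trans (sym (*-distribˡ-sum (weight dec e s) μ)) (trans (*-congˡ μ-sum) (*-identityʳ _))))) w≤1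
      ... | inj₂ (_ , eq) = (λ u → ≤-reflexive (sym (eq u))) , ≤-respˡ-≈ (sym (sum-zero eq)) 0≤1
      total₁ : ∃[ e ] IsTrace 𝓕 (e ∷ events β) → ∀ s →
        HasSum (λ e → IsTrace 𝓕 (e ∷ events β)) (λ e → weight dec e s) 1#
      total₁ (e , t) s with em {P = Live (events β)}
      ... | yes l = Row.w-sum (rowₗ l s)
      ... | no ¬l = contradiction (live t) ¬l

    τ-link : ∀ β e (t : IsTrace 𝓕 (e ∷ events β)) v u → τ β e t v u * inflow (events β) v ≈ outkernel (events β) e v u
    τ-link β e t v u with em {P = Live (events β)}
    ... | yes l = Row.link (rowₗ l v) e u
    ... | no ¬l = contradiction (live t) ¬l

    -- By linearity in the initial measure, one step of τ multiplies the inflow by its kernel, and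
    -- `link` turns this into the measure carried by the steps into the next fibre. At the empty
    -- trace the only entry is the root, with measure `p`.
    φ-inflow : ∀ {β} (t : IsTrace 𝓕 β) u → sum (λ s → p s * φ-list 𝓕 τ s β t u) ≈ inflow β u
    φ-inflow empty u = trans (sum-δˡ p u) (sym (trans
      (Σₗ-≋ (fibre-where-unique Entry []) ([] ∷ []) (here ∘ only-root) (λ { (here ≡.refl) → root∈ }) (λ _ → 0≤Φ _ u))
      (trans (+-identityʳ _) (proj₂ root-start u))))
      where
      root-start : f root ≡ [] × Φ root ≋ p
      root-start with kind root
      ... | inj₁ (_ , start) = start
      ... | inj₂ (inj₁ (_ , par , _)) with () ← ≡.trans (≡.sym parent-root) par
      ... | inj₂ (inj₂ (_ , par , _)) with () ← ≡.trans (≡.sym parent-root) par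
      root∈ : root ∈ entries []
      root∈ = ∈-fibre-where⁺ Entry (proj₁ root-start) λ (_ , par , _) → case ≡.trans (≡.sym parent-root) par of λ ()
      only-root : ∀ {y} → y ∈ entries [] → y ≡ root
      only-root {y} y∈ with ∈-fibre-where⁻ Entry y∈ | kind y
      ... | _  , _     | inj₁ (eq , _) = eq
      ... | _  , entry | inj₂ (inj₁ (x , par , f≡ , _)) = contradiction (x , par , ≡.sym f≡) entry
      ... | eq , _     | inj₂ (inj₂ (_ , _ , _ , f≡ , _)) with () ← ≡.trans (≡.sym eq) f≡
    φ-inflow {e ∷ β} t@(extend t′ _ _ _) u = begin-equality
      sum (λ s → p s * sum λ v → τ β′ e t v u * φₛ s v)  ≈⟨ sum-cong-≋ (λ s → *-distribˡ-sum (p s) (λ v → τ β′ e t v u * φₛ s v)) ⟩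
      sum (λ s → sum λ v → p s * (τ β′ e t v u * φₛ s v)) ≈⟨ ∑-comm (λ s v → p s * (τ β′ e t v u * φₛ s v)) ⟩
      sum (λ v → sum λ s → p s * (τ β′ e t v u * φₛ s v)) ≈⟨ sum-cong-≋ (λ v → sum-cong-≋ λ s → x∙yz≈y∙xz (p s) (τ β′ e t v u) (φₛ s v)) ⟩
      sum (λ v → sum λ s → τ β′ e t v u * (p s * φₛ s v)) ≈⟨ sum-cong-≋ (λ v → *-distribˡ-sum (τ β′ e t v u) (λ s → p s * φₛ s v)) ⟨
      sum (λ v → τ β′ e t v u * sum λ s → p s * φₛ s v)   ≈⟨ sum-cong-≋ (λ v → *-congˡ (φ-inflow t′ v)) ⟩
      sum (λ v → τ β′ e t v u * inflow β v)               ≈⟨ sum-cong-≋ (λ v → τ-link β′ e t v u) ⟩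
      sum (λ v → outkernel β e v u)                       ≈⟨ Σₗ-sum (λ y v → m y v * κ y v u) (entries (e ∷ β)) ⟨
      Σₗ (λ y → sum λ v → m y v * κ y v u) (entries (e ∷ β)) ≈⟨ Σₗ-cong (entries (e ∷ β)) (λ y∈ → proj₂ (proj₂ (proj₂ (entry-kind y∈))) u) ⟨
      inflow (e ∷ β) u                                    ∎
      where
      open ≤-Reasoning
      open import Algebra.Properties.CommutativeSemigroup *-commutativeSemigroup using (x∙yz≈y∙xz)
      β′ : Trace 𝓕
      β′ = ⟪ β , t′ ⟫
      φₛ : Ω → Point
      φₛ s v = φ-list 𝓕 τ s β t′ v

    private
      final-fibration : Fibration Final (λ (β : Trace 𝓕) → IsMaximal 𝓕 (events β)) (λ β x → Final x × f x ≡ events β)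
      final-fibration = record
        { cover    = λ {x} final → ⟪ f x , f-trace x ⟫ , final-max final , final , ≡.refl
        ; total⁻   = λ _ → proj₁
        ; disjoint = λ { {y = ⟪ _ , _ ⟫} {⟪ _ , _ ⟫} (_ , eq) (_ , eq′) → unique (≡.trans (≡.sym eq) eq′) }
        }
        where
        unique : ∀ {β γ} .{t : IsTrace 𝓕 β} .{t′ : IsTrace 𝓕 γ} → β ≡ γ → ⟪ β , t ⟫ ≡ ⟪ γ , t′ ⟫
        unique ≡.refl = ≡.refl

      -- Over a maximal `β` all inflow stops, so the mixed probability of `β` is the sum over the
      -- final nodes in its fibre.
      maximal-sum : ∀ {v} u → HasSum Final (λ x → Φ x u) v →
                    HasSum (λ β → IsMaximal 𝓕 (events β)) (λ β → sum λ s → p s * φ 𝓕 τ s β u) v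
      maximal-sum u = hasSum-base final-fibration λ {β} max →
        hasSum-≈ (trans (stopped-all (events β) u max) (sym (φ-inflow (proj₁ max) u)))
          (hasSum-finite (fibre-where-unique Final (events β)) (λ (final , eq) → ∈-fibre-where⁺ Final eq final)
            (λ x∈ → let eq , final = ∈-fibre-where⁻ Final x∈ in final , eq) (λ _ → 0≤Φ _ u))

    simulated : ∀ {V : Point} → (∀ s → 0# ≤ p s) → (∀ s → ¬ (p s ≈ 0#)) → sum V ≈ sum p →
      (∀ u → HasSum Final (λ x → Φ x u) (V u)) →
      Sched₁ 𝓕 τ × Σ[ μ ∈ (Ω → Point) ] (∀ s → Outcome 𝓕 τ s (μ s)) × (∀ u → sum (λ s → p s * μ s u) ≈ V u)
    simulated 0≤p p≉0 mass≈ final-sum = proj₁ mixed , (λ s → proj₁ (outcome s)) , (λ s → proj₂ (outcome s)) , proj₂ mixed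
      where
      open SchedulerProperties τ-isScheduler using (outcome)
      mixed = mixed-outcome τ-isScheduler 0≤p p≉0 mass≈ (λ u → maximal-sum u (final-sum u))

-- The tree of runs given by a t-simulation, and the limit argument.

module Simulation (em : ∀ {ℓ} → ExcludedMiddle ℓ) (ℝ : CompleteOrderedField) (n : ℕ) where

  open Programs ℝ n
  open CompleteOrderedField ℝ hiding (zero)
  open Summation em ℝ
  open Schedules em ℝ n
  open Transfer em ℝ n
  open Trace

  module _ {𝓔 𝓕 : IPBES} {f : Trace 𝓔 → Trace 𝓕} (sim : IsTSimulation 𝓔 𝓕 f)
           (empty-maximal : IsMaximal 𝓔 [] → IsWeaklyMaximal 𝓕 []) where
    open IsTSimulation sim
    private
      module E = IPBES 𝓔
      module F = IPBES 𝓕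

    Completion : Trace 𝓔 → List F.Event → Set₁
    Completion α γ = IsMaximal 𝓕 (γ ++ events (f α)) × All (λ e → δ ⊑ℍ ⟨ F.lab e ⟩) γ

    complete-weakly : ∀ {α} → IsWeaklyMaximal 𝓕 (events (f α)) → ∃ (Completion α)
    complete-weakly (inj₁ max) = [] , max , []
    complete-weakly (inj₂ weak) = weak

    completion-exists : ∀ α → IsMaximal 𝓔 (events α) → ∃ (Completion α)
    -- `f-maximal` speaks of non-empty traces only; the assumption `empty-maximal` covers this case.
    completion-exists ⟪ [] , _ ⟫ max = complete-weakly
      (≡.subst (λ β → IsWeaklyMaximal 𝓕 (events β)) (≡.sym f-empty) (empty-maximal max))
    completion-exists ⟪ e ∷ α , t ⟫ max = complete-weakly
      (proj₂ (f-maximal ⟪ α , prefix (proj₁ max) ⟫ e (proj₁ max) max))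

    choose : ∀ α → Dec (IsMaximal 𝓔 (events α)) → List F.Event
    choose α (yes max) = proj₁ (completion-exists α max)
    -- This default matters: a run whose source is not maximal can then have only the empty tail.
    choose α (no _)    = []

    completion : Trace 𝓔 → List F.Event
    completion α = choose α em

    completion-max : ∀ α → IsMaximal 𝓔 (events α) → IsMaximal 𝓕 (completion α ++ events (f α))
    completion-max α max with em {P = IsMaximal 𝓔 (events α)}
    ... | yes max′ = proj₁ (proj₂ (completion-exists α max′))
    ... | no ¬max  = contradiction max ¬max

    completion-δ : ∀ α → All (λ e → δ ⊑ℍ ⟨ F.lab e ⟩) (completion α)
    completion-δ α with em {P = IsMaximal 𝓔 (events α)}
    ... | yes max = proj₂ (proj₂ (completion-exists α max))
    ... | no _    = []

    completion-[] : ∀ α → ¬ IsMaximal 𝓔 (events α) → completion α ≡ []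
    completion-[] α ¬max with em {P = IsMaximal 𝓔 (events α)}
    ... | yes max = contradiction max ¬max
    ... | no _    = ≡.refl

    valid-trace : ∀ {𝓖} (α : Trace 𝓖) → IsTrace 𝓖 (events α)
    valid-trace ⟪ _ , t ⟫ = recompute em t

    completion-trace : ∀ α → IsTrace 𝓕 (completion α ++ events (f α))
    completion-trace α with em {P = IsMaximal 𝓔 (events α)}
    ... | yes max = proj₁ (proj₁ (proj₂ (completion-exists α max)))
    ... | no _    = valid-trace (f α)

    -- Lists hold the latest event first, so a suffix of a completion is the part of it performed so
    -- far.
    SuffixOf : List F.Event → List F.Event → Set
    SuffixOf ζ γ = ∃[ θ ] θ ++ γ ≡ ζ

    -- A run of 𝓔, continued once it is maximal by the δ-labelled events that make its image maximal.
    record Run : Set₁ where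
      constructor run
      field
        source : Trace 𝓔
        tail   : List F.Event
        .valid : SuffixOf (completion source) tail
    open Run

    []-suffix : ∀ {ζ} → SuffixOf ζ []
    []-suffix {ζ} = ζ , ++-identityʳ ζ

    ∷-suffix : ∀ {ζ c γ} → SuffixOf ζ (c ∷ γ) → SuffixOf ζ γ
    ∷-suffix {c = c} {γ} (θ , eq) = θ ++ c ∷ [] , ≡.trans (++-assoc θ (c ∷ []) γ) eq

    -- The completion is a fixed list, so its next event is determined; a pending run therefore has
    -- just one child.
    suffix-head : ∀ {ζ c c′ γ} → SuffixOf ζ (c ∷ γ) → SuffixOf ζ (c′ ∷ γ) → c ≡ c′
    suffix-head {c = c} {c′} {γ} (θ , eq) (θ′ , eq′) = ∷ʳ-injectiveʳ θ θ′ (++-cancelʳ γ _ _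
      (≡.trans (proj₂ (∷-suffix (θ , eq))) (≡.sym (proj₂ (∷-suffix (θ′ , eq′))))))

    suffix-grow : ∀ {ζ γ} → SuffixOf ζ γ → γ ≡ ζ ⊎ ∃[ c ] SuffixOf ζ (c ∷ γ)
    suffix-grow {γ = γ} (θ , eq) with initLast θ
    ... | []       = inj₁ eq
    ... | θ′ ∷ʳ′ c = inj₂ (c , θ′ , ≡.trans (≡.sym (++-assoc θ′ (c ∷ []) γ)) eq)

    suffix-full : ∀ {c ζ} → ¬ SuffixOf ζ (c ∷ ζ)
    suffix-full {c} {ζ} (θ , eq) = ℕ.<⇒≢ (≡.subst (length ζ ℕ.<_) (≡.sym (length-++ θ)) (ℕ.m≤n+m _ (length θ)))
      (≡.cong length (≡.sym eq))

    suffix-[] : ∀ {c γ} → ¬ SuffixOf [] (c ∷ γ)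
    suffix-[] ([] , ())
    suffix-[] (_ ∷ _ , ())

    suffix-∈ : ∀ {ζ c γ} → SuffixOf ζ (c ∷ γ) → c ∈ ζ
    suffix-∈ (θ , ≡.refl) = ∈-++⁺ʳ θ (here ≡.refl)

    image : Run → List F.Event
    image x = tail x ++ events (f (source x))

    image-trace : ∀ x → IsTrace 𝓕 (image x)
    image-trace (run α γ v) with θ , eq ← recompute em v =
      suffix θ (≡.subst (IsTrace 𝓕) (≡.trans (≡.cong (_++ _) (≡.sym eq)) (++-assoc θ γ _)) (completion-trace α))

    parent : Run → Maybe Run
    parent (run α (c ∷ γ) v)        = just (run α γ (∷-suffix v))
    parent (run ⟪ [] , _ ⟫ [] _)    = nothing
    parent (run ⟪ e ∷ α , t ⟫ [] _) = just (run ⟪ α , prefix t ⟫ [] []-suffix)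

    root : Run
    root = run ⟪ [] , empty ⟫ [] []-suffix

    ends : Trace 𝓔 → List Run
    ends α = run α [] []-suffix ∷ []

    lengthen : F.Event → Run → List Run
    lengthen c (run α γ _) with em {P = SuffixOf (completion α) (c ∷ γ)}
    ... | yes v = run α (c ∷ γ) v ∷ []
    ... | no _  = []

    lengthen-∈ : ∀ {c α γ} .(v : SuffixOf (completion α) (c ∷ γ)) .(v′ : SuffixOf (completion α) γ) →
                 run α (c ∷ γ) v ∈ lengthen c (run α γ v′)
    lengthen-∈ {c} {α} {γ} v v′ with em {P = SuffixOf (completion α) (c ∷ γ)}
    ... | yes _ = here ≡.refl
    ... | no ¬v = contradiction (recompute em v) ¬v

    sources : List F.Event → List (Trace 𝓔)
    sources β with em {P = IsTrace 𝓕 β}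
    ... | yes t = proj₁ (f-finite ⟪ β , t ⟫)
    ... | no _  = []

    sources-∈ : ∀ α → α ∈ sources (events (f α))
    sources-∈ α with em {P = IsTrace 𝓕 (events (f α))}
    ... | yes t = proj₂ (f-finite ⟪ events (f α) , t ⟫) α ≡.refl
    ... | no ¬t = contradiction (valid-trace (f α)) ¬t

    -- Covers the fibre of `image`. The recursion is on the image: either the tail is empty and `f`
    -- of the source is the whole trace, or removing the last event leaves a shorter run over `β`.
    runs : List F.Event → List Run
    runs []      = concatMap ends (sources [])
    runs (c ∷ β) = concatMap ends (sources (c ∷ β)) ++ concatMap (lengthen c) (runs β)

    runs-∈ : ∀ α γ .(v : SuffixOf (completion α) γ) → run α γ v ∈ runs (γ ++ events (f α))
    runs-∈ α (c ∷ γ) v = ∈-++⁺ʳ (concatMap ends (sources (c ∷ γ ++ events (f α))))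
      (∈-concatMap⁺ (lengthen c) (lose (runs-∈ α γ (∷-suffix v)) (lengthen-∈ v (∷-suffix v))))
    runs-∈ α [] v = short (events (f α)) (∈-concatMap⁺ ends (lose (sources-∈ α) (here ≡.refl)))
      where
      short : ∀ β {x} → x ∈ concatMap ends (sources β) → x ∈ runs β
      short []      x∈ = x∈
      short (c ∷ β) x∈ = ∈-++⁺ˡ x∈

    data Shape (x : Run) : Set₁ where
      running   : ∀ {e} → IsTrace 𝓔 (e ∷ events (source x)) → tail x ≡ [] → Shape x
      pending   : ∀ {c} → IsMaximal 𝓔 (events (source x)) → SuffixOf (completion (source x)) (c ∷ tail x) → Shape x
      completed : IsMaximal 𝓔 (events (source x)) → tail x ≡ completion (source x) → Shape x

    shape : ∀ x → Shape x
    shape x@(run α γ v) = classify em (recompute em v)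
      where
      classify : Dec (IsMaximal 𝓔 (events α)) → SuffixOf (completion α) γ → Shape x
      classify (yes max) s with suffix-grow s
      ... | inj₁ eq       = completed max eq
      ... | inj₂ (_ , s′) = pending max s′
      classify (no ¬max) (θ , eq) with maximal-or-extends (valid-trace α)
      ... | inj₁ max     = contradiction max ¬max
      ... | inj₂ (_ , t) = running t (++-conicalʳ θ γ (≡.trans eq (completion-[] α ¬max)))

    module _ {σ : PreScheduler 𝓔} (isSched : IsScheduler 𝓔 σ) {p : Point} (0≤p : ∀ s → 0# ≤ p s) where
      open SchedulerProperties isSched

      reach : Trace 𝓔 → Point
      reach α u = sum λ s → p s * φ 𝓔 σ s α u

      0≤reach : ∀ α u → 0# ≤ reach α u
      0≤reach α u = sum-nonNeg λ s → *-nonNeg (0≤p s) (0≤φ s (valid-trace α) u)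

      -- The step of σ without its weight. Where the label is empty the weight is zero and the point
      -- distribution is an arbitrary default, so the factorisation `law-σ` holds in every state.
      law : ∀ α e → IsTrace 𝓔 (e ∷ events α) → Ω → Point
      law α e t v with kernel α e t v
      ... | inj₁ (μ , _) = μ
      ... | inj₂ _       = δ[ v ]

      law-σ : ∀ α e (t : IsTrace 𝓔 (e ∷ events α)) v → σ α e t v ≋ weight α e v · law α e t v
      law-σ α e t v with kernel α e t v
      ... | inj₁ (_ , _ , eq)   = eq
      ... | inj₂ (_ , w≈0 , eq) = λ u → trans (eq u) (sym (trans (*-congʳ w≈0) (zeroˡ _)))

      law-∈ : ∀ α e (t : IsTrace 𝓔 (e ∷ events α)) v → weight α e v ≈ 0# ⊎ ⟨ E.lab e ⟩ v (law α e t v)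
      law-∈ α e t v with kernel α e t v
      ... | inj₁ (_ , μ∈ , _)  = inj₂ μ∈
      ... | inj₂ (_ , w≈0 , _) = inj₁ w≈0

      -- A completing event takes all the mass and keeps the state, so `reached` does not look at
      -- the tail and `sent` carries no weight there.
      reached sent : Run → Point
      reached x = reach (source x)
      sent (run α (c ∷ γ) _)        = reach α
      sent (run ⟪ [] , _ ⟫ [] _)    = 𝟎
      sent (run ⟪ e ∷ α , t ⟫ [] _) = λ v → weight ⟪ α , prefix t ⟫ e v * reach ⟪ α , prefix t ⟫ v

      laws : Run → Ω → Point
      laws (run α (c ∷ γ) _)        v = δ[ v ]
      laws (run ⟪ [] , _ ⟫ [] _)    v = δ[ v ]
      laws (run ⟪ e ∷ α , t ⟫ [] _) v = law ⟪ α , prefix t ⟫ e (recompute em t) v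

      0≤sent : ∀ x u → 0# ≤ sent x u
      0≤sent (run ⟪ [] , _ ⟫ [] _)    u = ≤-refl
      0≤sent (run ⟪ e ∷ α , t ⟫ [] _) u = *-nonNeg (0≤weight _ e u) (0≤reach ⟪ α , prefix t ⟫ u)
      0≤sent (run α (c ∷ γ) _)        u = 0≤reach α u

      reach-extend : ∀ {α e} (t : IsTrace 𝓔 (e ∷ α)) u → let α′ = ⟪ α , prefix t ⟫ in
        reach ⟪ e ∷ α , t ⟫ u ≈ sum λ v → weight α′ e v * reach α′ v * law α′ e t v u
      reach-extend {α} {e} t u = begin-equality
        sum (λ s → p s * sum λ v → σ α′ e t v u * φₛ s v)   ≈⟨ sum-cong-≋ (λ s → *-distribˡ-sum (p s) (λ v → σ α′ e t v u * φₛ s v)) ⟩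
        sum (λ s → sum λ v → p s * (σ α′ e t v u * φₛ s v)) ≈⟨ ∑-comm (λ s v → p s * (σ α′ e t v u * φₛ s v)) ⟩
        sum (λ v → sum λ s → p s * (σ α′ e t v u * φₛ s v)) ≈⟨ sum-cong-≋ (λ v → sum-cong-≋ λ s → x∙yz≈y∙xz (p s) (σ α′ e t v u) (φₛ s v)) ⟩
        sum (λ v → sum λ s → σ α′ e t v u * (p s * φₛ s v)) ≈⟨ sum-cong-≋ (λ v → *-distribˡ-sum (σ α′ e t v u) (λ s → p s * φₛ s v)) ⟨
        sum (λ v → σ α′ e t v u * reach α′ v)               ≈⟨ sum-cong-≋ (λ v → *-congʳ (law-σ α′ e t v u)) ⟩
        sum (λ v → weight α′ e v * law α′ e t v u * reach α′ v)  ≈⟨ sum-cong-≋ (λ v → xy∙z≈xz∙y (weight α′ e v) (law α′ e t v u) (reach α′ v)) ⟩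
        sum (λ v → weight α′ e v * reach α′ v * law α′ e t v u)  ∎
        where
        open ≤-Reasoning
        open import Algebra.Properties.CommutativeSemigroup *-commutativeSemigroup using (x∙yz≈y∙xz; xy∙z≈xz∙y)
        α′ : Trace 𝓔
        α′ = ⟪ α , prefix t ⟫
        φₛ : Ω → Point
        φₛ s v = φ-list 𝓔 σ s α (prefix t) v

      -- Wherever the weight is non-zero the law belongs to the label and hence is a point
      -- distribution, which collapses the sum over previous states.
      reach-stutter : ∀ {α e} (t : IsTrace 𝓔 (e ∷ α)) → ⟨ E.lab e ⟩ ⊑ℍ δ → ∀ u →
        reach ⟪ e ∷ α , t ⟫ u ≈ weight ⟪ α , prefix t ⟫ e u * reach ⟪ α , prefix t ⟫ u
      reach-stutter {α} {e} t ⊑δ u = trans (reach-extend t u) (trans (sum-cong-≋ eq)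
        (sum-δˡ (λ v → weight α′ e v * reach α′ v) u))
        where
        α′ : Trace 𝓔
        α′ = ⟪ α , prefix t ⟫
        eq : ∀ v → weight α′ e v * reach α′ v * law α′ e t v u ≈ weight α′ e v * reach α′ v * δ[ v ] u
        eq v with law-∈ α′ e t v
        ... | inj₁ w≈0 = let z = trans (*-congʳ w≈0) (zeroˡ (reach α′ v)) in
          trans (*-congʳ z) (trans (zeroˡ _) (sym (trans (*-congʳ z) (zeroˡ _))))
        ... | inj₂ ∈e  = *-congˡ (⊑δ v ∈e u)

      Final : Run → Set₁
      Final x = ∀ y → parent y ≢ just x

      completed-final : ∀ {x} → IsMaximal 𝓔 (events (source x)) → tail x ≡ completion (source x) → Final x
      completed-final max eq (run ⟪ e ∷ α , t ⟫ [] _) ≡.refl = extends⇒¬maximal (recompute em t) max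
      completed-final max ≡.refl (run α (c ∷ γ) v) ≡.refl = suffix-full (recompute em v)

      final-completed : ∀ {x} → Final x → IsMaximal 𝓔 (events (source x)) × tail x ≡ completion (source x)
      final-completed {x} final with shape x
      ... | running t ≡.refl = contradiction ≡.refl (final (run ⟪ _ , t ⟫ [] []-suffix))
      ... | pending max s    = contradiction ≡.refl (final (run (source x) (_ ∷ tail x) s))
      ... | completed max eq = max , eq

      running-flow : ∀ α → (∃[ e ] IsTrace 𝓔 (e ∷ events α)) → ∀ t →
        HasSum (λ y → parent y ≡ just (run α [] []-suffix)) (λ y → sent y t) (reach α t)
      running-flow α ext@(e , tr) t = hasSum-total fibration single (hasSum-cong (λ t → t) (λ t → t) (λ _ → *-comm _ _)
        (hasSum-≈ (*-identityʳ _) (hasSum-* (0≤reach α t) (weight-sum α tr t))))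
        where
        Child : E.Event → Run → Set₁
        Child e y = ∃[ tr ] y ≡ run ⟪ e ∷ events α , tr ⟫ [] []-suffix
        fibration : Fibration (λ y → parent y ≡ just (run α [] []-suffix)) (λ e → IsTrace 𝓔 (e ∷ events α)) Child
        fibration = record
          { cover    = cover
          ; total⁻   = λ { _ (_ , ≡.refl) → ≡.refl }
          ; disjoint = λ { (_ , ≡.refl) (_ , ≡.refl) → ≡.refl }
          }
          where
          cover : ∀ {y} → parent y ≡ just (run α [] []-suffix) → ∃[ e ] IsTrace 𝓔 (e ∷ events α) × Child e y
          cover {run ⟪ e ∷ α , t ⟫ [] _} ≡.refl = e , recompute em t , recompute em t , ≡.refl
          -- A child with a non-empty tail would complete a trace that can still be extended, whose
          -- completion is empty.
          cover {run α (c ∷ []) v} ≡.refl =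
            contradiction (≡.subst (λ ζ → SuffixOf ζ (c ∷ [])) (completion-[] α (extends⇒¬maximal tr)) (recompute em v)) suffix-[]
        single : ∀ {e} → IsTrace 𝓔 (e ∷ events α) → HasSum (Child e) (λ y → sent y t) (weight α e t * reach α t)
        single {e} tr = hasSum-singleton {x = run ⟪ e ∷ events α , tr ⟫ [] []-suffix} (tr , ≡.refl) (λ { (_ , ≡.refl) → ≡.refl })
          (*-nonNeg (0≤weight α e t) (0≤reach α t))

      simulation-flow : ∀ x → ¬ Final x → ∀ t → HasSum (λ y → parent y ≡ just x) (λ y → sent y t) (reached x t)
      simulation-flow x@(run α γ v) ¬final t with shape x
      ... | running tr ≡.refl = running-flow α (_ , tr) t
      ... | completed max eq  = contradiction (completed-final max eq) ¬final
      ... | pending {c} max s = hasSum-singleton {x = run α (c ∷ γ) s} ≡.refl unique (0≤reach α t)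
        where
        unique : ∀ {y} → parent y ≡ just x → y ≡ run α (c ∷ γ) s
        unique {run ⟪ e ∷ _ , t ⟫ [] _} ≡.refl = contradiction max (extends⇒¬maximal (recompute em t))
        unique {run _ (c′ ∷ _) v} ≡.refl with ≡.refl ← suffix-head s (recompute em v) = ≡.refl

      simulation-source : Source 𝓕 p
      simulation-source = record
        { Node = Run ; root = root ; parent = parent ; f = image ; Φ = reached ; m = sent ; κ = laws
        ; 0≤Φ         = λ x → 0≤reach (source x)
        ; 0≤m         = 0≤sent
        ; f-trace     = image-trace
        ; f-finite    = λ β → runs β , λ { (run α γ v) ≡.refl → runs-∈ α γ v }
        ; parent-root = ≡.refl
        ; kind        = kind
        ; flow        = simulation-flow
        ; final-max   = λ {x} final → let max , eq = final-completed {x} final in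
            ≡.subst (λ γ → IsMaximal 𝓕 (γ ++ events (f (source x)))) (≡.sym eq) (completion-max (source x) max)
        }
        where
        kind : ∀ y → _ ⊎ _ ⊎ _
        kind y@(run ⟪ [] , _ ⟫ [] _) = inj₁ (≡.refl , ≡.cong events f-empty , λ u → sum-δˡ p u)
        kind y@(run ⟪ e ∷ α , t ⟫ [] _) with tr ← recompute em t | f-step ⟪ α , prefix t ⟫ e tr
        ... | inj₁ (eq , ⊑δ) = inj₂ (inj₁ (_ , ≡.refl , ≡.cong events eq , reach-stutter tr ⊑δ))
        ... | inj₂ (e′ , ⊑e′ , eq) = inj₂ (inj₂ (_ , ≡.refl , e′ , eq , (λ v → carried v (law-∈ ⟪ α , prefix t ⟫ e tr v)) , reach-extend tr))
          where
          carried : ∀ v → weight ⟪ α , prefix t ⟫ e v ≈ 0# ⊎ ⟨ E.lab e ⟩ v (law ⟪ α , prefix t ⟫ e tr v) → _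
          carried v (inj₁ w≈0) = inj₁ (trans (*-congʳ w≈0) (zeroˡ _))
          carried v (inj₂ ∈e)  = inj₂ (⊑e′ v ∈e)
        kind y@(run α (c ∷ γ) v) = inj₂ (inj₂ (_ , ≡.refl , c , ≡.refl ,
          (λ t → inj₂ (All.lookup (completion-δ α) (suffix-∈ (recompute em v)) t λ _ → refl)) ,
          λ u → sym (sum-δˡ (reach α) u)))

      -- Final runs correspond one to one to maximal traces of 𝓔: each such trace together with its
      -- full completion.
      final-sum : ∀ {μ : Ω → Point} → (∀ s → Outcome 𝓔 σ s (μ s)) → ∀ u →
        HasSum Final (λ x → reached x u) (sum λ s → p s * μ s u)
      final-sum out u = hasSum-total fibration single
        (hasSum-sum (λ max s → *-nonNeg (0≤p s) (0≤φ s (proj₁ max) u)) (λ s → hasSum-* (0≤p s) (out s u)))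
        where
        Ends : Trace 𝓔 → Run → Set₁
        Ends α x = source x ≡ α × tail x ≡ completion α
        fibration : Fibration Final Max Ends
        fibration = record
          { cover    = λ {x} final → source x , proj₁ (final-completed {x} final) , ≡.refl , proj₂ (final-completed {x} final)
          ; total⁻   = λ { max (≡.refl , eq) → completed-final max eq }
          ; disjoint = λ { (≡.refl , _) (≡.refl , _) → ≡.refl }
          }
        single : ∀ {α} → Max α → HasSum (Ends α) (λ x → reached x u) (reach α u)
        single {α} _ = hasSum-singleton {x = run α (completion α) ([] , ≡.refl)} (≡.refl , ≡.refl)
          (λ { (≡.refl , ≡.refl) → ≡.refl }) (0≤reach α u)

  module _ {𝓔 𝓕 : IPBES} (feasible : Feasible 𝓕) {f : Trace 𝓔 → Trace 𝓕} (sim : IsTSimulation 𝓔 𝓕 f)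
           (empty-maximal : IsMaximal 𝓔 [] → IsWeaklyMaximal 𝓕 []) where

    -- Non-strict, as the averaging in `mean` needs it. The strictness in `Near` comes from the
    -- other approximation, that of `x` by a point of the convex hull.
    Near≤ : Carrier → Point → Point → Set
    Near≤ ε x y = ∀ u → x u ≤ y u + ε × y u ≤ x u + ε

    outcome-approx : ∀ {s} {σ} {μ : Point} → Sched₁ 𝓔 σ → Outcome 𝓔 σ s μ → ∀ {ε} → 0# < ε →
      ∃[ ν ] (∃[ τ ] Sched₁ 𝓕 τ × Outcome 𝓕 τ s ν) × Near≤ ε μ ν
    outcome-approx {s} {σ} {μ} (isSched , total) out {ε} (0≤ε , 0≉ε) =
      ν s , (_ , sched , ν-out s) , λ u →
        ≤-respˡ-≈ (hasSum-unique (μ-out s u) (out u)) (bound μ-dist ν-dist mix u) ,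
        ≤-respʳ-≈ (+-congʳ (hasSum-unique (μ-out s u) (out u))) (bound ν-dist μ-dist (λ u → sym (mix u)) u)
      where
      N = sum {n} (λ _ → 1#)
      0≤N : 0# ≤ N
      0≤N = sum-nonNeg {n} λ _ → 0≤1
      1+N≉0 : ¬ (1# + N ≈ 0#)
      1+N≉0 eq = 1≉0 (antisym (≤-respʳ-≈ eq (x≤x+y 0≤N)) 0≤1)
      inv = inverse⁺ (+-nonNeg 0≤1 0≤N) 1+N≉0
      -- This is `ε` divided by one plus the number `N` of states: the added initial mass `η * N`
      -- stays below `ε`, and the extra one makes the divisor non-zero.
      η = ε * proj₁ inv
      0≤η : 0# ≤ η
      0≤η = *-nonNeg 0≤ε (proj₁ (proj₂ inv))
      [1+N]η≈ε : (1# + N) * η ≈ ε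
      [1+N]η≈ε = begin-equality
        (1# + N) * (ε * proj₁ inv)  ≈⟨ x∙yz≈y∙xz _ _ _ ⟩
        ε * ((1# + N) * proj₁ inv)  ≈⟨ *-congˡ (proj₂ (proj₂ inv)) ⟩
        ε * 1#                      ≈⟨ *-identityʳ ε ⟩
        ε                           ∎
        where
        open ≤-Reasoning
        open import Algebra.Properties.CommutativeSemigroup *-commutativeSemigroup using (x∙yz≈y∙xz)
      η≉0 : ¬ (η ≈ 0#)
      η≉0 eq = 0≉ε (sym (trans (sym [1+N]η≈ε) (trans (*-congˡ eq) (zeroʳ _))))
      ηN≤ε : η * N ≤ ε
      ηN≤ε = ≤-respʳ-≈ (trans (*-comm η (1# + N)) [1+N]η≈ε) (*-monoˡ-≤ 0≤η (x≤y+x 0≤1))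
      p : Point
      p s′ = δ[ s ] s′ + η
      0≤p : ∀ s′ → 0# ≤ p s′
      0≤p s′ = +-nonNeg (δ-nonNeg s s′) 0≤η
      p≉0 : ∀ s′ → ¬ (p s′ ≈ 0#)
      p≉0 s′ eq = η≉0 (antisym (≤-respʳ-≈ eq (x≤y+x (δ-nonNeg s s′))) 0≤η)
      μ′ : Ω → Point
      μ′ s′ = proj₁ (total s′)
      μ-out : ∀ s′ → Outcome 𝓔 σ s′ (μ′ s′)
      μ-out s′ = proj₁ (proj₂ (total s′))
      μ-dist : ∀ s′ → IsDist (μ′ s′)
      μ-dist s′ = proj₂ (proj₂ (total s′))
      mass≈ : sum (λ u → sum λ s′ → p s′ * μ′ s′ u) ≈ sum p
      mass≈ = trans (∑-comm (λ u s′ → p s′ * μ′ s′ u)) (sum-cong-≋ λ s′ →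
        trans (sym (*-distribˡ-sum (p s′) (μ′ s′))) (trans (*-congˡ (proj₂ (μ-dist s′))) (*-identityʳ _)))
      source = simulation-source sim empty-maximal isSched 0≤p
      simulation = Simulated.simulated feasible source 0≤p p≉0 mass≈
        (final-sum sim empty-maximal isSched 0≤p μ-out)
      sched = proj₁ simulation
      ν = proj₁ (proj₂ simulation)
      ν-out = proj₁ (proj₂ (proj₂ simulation))
      mix = proj₂ (proj₂ (proj₂ simulation))
      ν-dist : ∀ s′ → IsDist (ν s′)
      ν-dist s′ = sched₁-dist {σ = Simulated.τ feasible source} sched (ν-out s′)
      expand : ∀ (x : Ω → Point) u → sum (λ s′ → p s′ * x s′ u) ≈ x s u + η * sum (λ s′ → x s′ u)
      expand x u = begin-equality
        sum (λ s′ → p s′ * x s′ u)                               ≈⟨ sum-cong-≋ (λ s′ → distribʳ (x s′ u) (δ[ s ] s′) η) ⟩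
        sum (λ s′ → δ[ s ] s′ * x s′ u + η * x s′ u)             ≈⟨ ∑-distrib-+ (λ s′ → δ[ s ] s′ * x s′ u) (λ s′ → η * x s′ u) ⟩
        sum (λ s′ → δ[ s ] s′ * x s′ u) + sum (λ s′ → η * x s′ u) ≈⟨ +-cong
          (trans (sum-cong-≋ λ s′ → *-comm (δ[ s ] s′) (x s′ u)) (sum-δʳ (λ s′ → x s′ u) s))
          (sym (*-distribˡ-sum η (λ s′ → x s′ u))) ⟩
        x s u + η * sum (λ s′ → x s′ u)                          ∎
        where open ≤-Reasoning
      -- Both families have the same `p`-mixture. Dropping the `η` part on the side of `x` and
      -- estimating it by `η * N` on the side of `y` leaves an error of `ε`; the two directions
      -- exchange `x` and `y`.
      bound : ∀ {x y : Ω → Point} → (∀ s′ → IsDist (x s′)) → (∀ s′ → IsDist (y s′)) →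
        (∀ u → sum (λ s′ → p s′ * y s′ u) ≈ sum (λ s′ → p s′ * x s′ u) ) → ∀ u → x s u ≤ y s u + ε
      bound {x} {y} x-dist y-dist eq u = begin
        x s u                              ≤⟨ x≤x+y (*-nonNeg 0≤η (sum-nonNeg λ s′ → proj₁ (x-dist s′) u)) ⟩
        x s u + η * sum (λ s′ → x s′ u)    ≈⟨ expand x u ⟨
        sum (λ s′ → p s′ * x s′ u)         ≈⟨ eq u ⟨
        sum (λ s′ → p s′ * y s′ u)         ≈⟨ expand y u ⟩
        y s u + η * sum (λ s′ → y s′ u)    ≤⟨ +-mono-≤ ≤-refl (≤-trans (*-monoˡ-≤ 0≤η (sum-mono-≤ λ s′ →
          ≤-respʳ-≈ (proj₂ (y-dist s′)) (≤-sum (proj₁ (y-dist s′)) u))) ηN≤ε) ⟩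
        y s u + ε                          ∎
        where open ≤-Reasoning

    semantics-⊆ : ∀ {s x} → ⟦ 𝓔 ⟧ s x → ⟦ 𝓕 ⟧ s x
    semantics-⊆ {s} {x} x∈ ε (0≤ε , 0≉ε) = approximate (x∈ h 0<h)
      where
      2≉0 : ¬ (1# + 1# ≈ 0#)
      2≉0 eq = 1≉0 (antisym (≤-respʳ-≈ eq (x≤x+y 0≤1)) 0≤1)
      inv = inverse⁺ (+-nonNeg 0≤1 0≤1) 2≉0
      -- Half of `ε` pays for the passage from `x` to a point of the hull, the other half for
      -- replacing the outcomes it averages, with the coefficients kept.
      h = ε * proj₁ inv
      h+h≈ε : h + h ≈ ε
      h+h≈ε = begin-equality
        ε * proj₁ inv + ε * proj₁ inv     ≈⟨ distribˡ ε _ _ ⟨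
        ε * (proj₁ inv + proj₁ inv)       ≈⟨ *-congˡ (+-cong (*-identityˡ _) (*-identityˡ _)) ⟨
        ε * (1# * proj₁ inv + 1# * proj₁ inv) ≈⟨ *-congˡ (distribʳ (proj₁ inv) 1# 1#) ⟨
        ε * ((1# + 1#) * proj₁ inv)       ≈⟨ *-congˡ (proj₂ (proj₂ inv)) ⟩
        ε * 1#                            ≈⟨ *-identityʳ ε ⟩
        ε                                 ∎
        where open ≤-Reasoning
      0<h : 0# < h
      0<h = *-nonNeg 0≤ε (proj₁ (proj₂ inv)) , λ 0≈h → 0≉ε (begin-equality
        0#       ≈⟨ +-identityˡ 0# ⟨
        0# + 0#  ≈⟨ +-cong 0≈h 0≈h ⟩
        h + h    ≈⟨ h+h≈ε ⟩
        ε        ∎)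
        where open ≤-Reasoning
      closer : ∀ {a b} → a < h → b ≤ h → a + b < ε
      closer (a≤h , a≉h) b≤h = ≤-respʳ-≈ h+h≈ε (+-mono-≤ a≤h b≤h) , λ eq → a≉h (antisym a≤h
        (+-cancelʳ-≤ h (≤-trans (≤-reflexive (trans h+h≈ε (sym eq))) (+-mono-≤ ≤-refl b≤h))))
      telescope : ∀ a b c → (a - b) + (b - c) ≈ a - c
      telescope a b c = trans (sym (+-assoc (a - b) b (- c))) (+-congʳ (x-y+y≈x a b))
      <-respˡ : ∀ {a b c} → a ≈ b → a < c → b < c
      <-respˡ a≈b (a≤c , a≉c) = ≤-respˡ-≈ a≈b a≤c , λ b≈c → a≉c (trans a≈b b≈c)
      approximate : ∃[ y ] ConvexHull (λ μ → ∃[ σ ] Sched₁ 𝓔 σ × Outcome 𝓔 σ s μ) y × Near h x y →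
                    ∃[ z ] ConvexHull (λ μ → ∃[ τ ] Sched₁ 𝓕 τ × Outcome 𝓕 τ s μ) z × Near ε x z
      approximate (y , (k , c , μ , 0≤c , c-sum , μ∈ , y≋) , near) =
        (λ u → sum λ i → c i * ν i u) , (k , c , ν , 0≤c , c-sum , (λ i → proj₁ (proj₂ (at i))) , λ _ → refl) , λ u →
          <-respˡ (telescope (x u) (y u) _) (closer (proj₁ (near u)) (x≤y+z⇒x-y≤z
            (≤-respˡ-≈ (sym (y≋ u)) (mean λ i → proj₁ (proj₂ (proj₂ (at i)) u))))) ,
          <-respˡ (trans (+-comm _ _) (telescope _ (y u) (x u))) (closer (proj₂ (near u)) (x≤y+z⇒x-y≤z
            (≤-respʳ-≈ (+-congʳ (sym (y≋ u))) (mean λ i → proj₂ (proj₂ (proj₂ (at i)) u)))))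
        where
        at = λ i → outcome-approx (proj₁ (proj₂ (μ∈ i))) (proj₂ (proj₂ (μ∈ i))) 0<h
        ν : Vector Point k
        ν i = proj₁ (at i)
        mean : ∀ {a b : Vector Carrier k} → (∀ i → a i ≤ b i + h) → sum (λ i → c i * a i) ≤ sum (λ i → c i * b i) + h
        mean {a} {b} le = begin
          sum (λ i → c i * a i)                        ≤⟨ sum-mono-≤ (λ i → *-monoˡ-≤ (0≤c i) (le i)) ⟩
          sum (λ i → c i * (b i + h))                  ≈⟨ sum-cong-≋ (λ i → distribˡ (c i) (b i) h) ⟩
          sum (λ i → c i * b i + c i * h)              ≈⟨ ∑-distrib-+ (λ i → c i * b i) (λ i → c i * h) ⟩
          sum (λ i → c i * b i) + sum (λ i → c i * h)  ≈⟨ +-congˡ (trans (sym (*-distribʳ-sum h c)) (trans (*-congʳ c-sum) (*-identityˡ h))) ⟩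
          sum (λ i → c i * b i) + h                    ∎
          where open ≤-Reasoning

theorem4p13 : (∀ {ℓ} → ExcludedMiddle ℓ) → (ℝ : CompleteOrderedField) (n : ℕ) → let open Programs ℝ n in
    (𝓔 𝓕 : IPBES) →
    Feasible 𝓔 → Feasible 𝓕 →
    Terminating 𝓔 → Terminating 𝓕 →
    (IsMaximal 𝓔 [] → IsWeaklyMaximal 𝓕 []) →
    𝓔 ⊑sim 𝓕 → 𝓔 ⊑ 𝓕
theorem4p13 em ℝ n 𝓔 𝓕 _ feasible _ _ empty-maximal (_ , sim) s = Simulation.semantics-⊆ em ℝ n feasible sim empty-maximal
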